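{- There exists an explicit sequence $g=\{g_n\}_{n\in\mathbb{N}}$ of monotone Boolean functions, where $g_n:\{0,1\}^{n\log n}\to\{0,1\}$, such that: (i) $g\in\mathsf{AC}^0$; in fact each $g_n$ is computed by a $\mathrm{poly}(n)$-size, depth-$3$ $\mathsf{AND}/\mathsf{OR}/\mathsf{NOT}$ circuit. (ii) For any constant $d\ge 2$, any depth-$d$ monotone majority circuit for $g_n$ must have size $2^{\Omega(n^{1/d})}$ (where the constant hidden in $\Omega(\cdot)$ may depend on $d$).
   Context: Logarithms are base $2$; the number of input bits $n\log n$ is understood to be rounded to an integer. $\mathsf{AC}^0$ is the class of sequences of Boolean functions computed by constant-depth, polynomial-size circuits of unbounded fan-in $\mathsf{AND}$ and $\mathsf{OR}$ gates and $\mathsf{NOT}$ gates; $\mathsf{NOT}$ gates are applied to input variables only and are not counted in the depth. A monotone majority circuit is a directed acyclic graph which may have multiple edges (called wires), with a single node with no outgoing wires, called the output gate. Nodes with no incoming wires are input nodes, each labeled $0$, $1$ or one of the input variables. Every other node (gate) is labeled with a monotone unweighted threshold gate $\mathsf{THR}_{t,m}$ for some integer $t$, where $m$ is its in-degree (counted with multiplicity); it outputs $1$ iff at least $t$ of its $m$ input wires carry the value $1$. The size of a gate $\mathsf{THR}_{t,m}$ is $m$, and the size of a circuit is the sum of the sizes of its gates (i.e. its number of wires). Depth is the maximum number of gates on a directed path from an input node to the output gate; a depth-$d$ circuit is one of depth at most $d$. -}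

module Defs where

open import Data.Bool.Base as Bool using (Bool; not)
open import Data.Bool.ListAction using (and; or)
open import Data.Empty using (⊥)
open import Data.Fin.Base using (Fin; zero; suc)
open import Data.Integer.Base as ℤ using (ℤ)
open import Data.List.Base using (filterᵇ; length)
open import Data.List.Membership.Propositional using (_∈_)
open import Data.List.NonEmpty.Base as List⁺ using (List⁺; toList; foldr₁)
open import Data.Nat.Base using (ℕ; zero; suc; _+_; _*_; _^_; _≤_; _⊔_; NonZero)
open import Data.Nat.Logarithm using (⌈log₂_⌉)
open import Data.Product.Base using (Σ-syntax; ∃-syntax; _×_)
open import Data.Sum.Base using (_⊎_)
open import Data.Vec.Base using (Vec; []; _∷_; lookup)
open import Data.Vec.Relation.Binary.Pointwise.Inductive using (Pointwise)
open import Function.Base using (id)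
open import Function.Bundles using (_⇔_)
open import Relation.Binary.PropositionalEquality.Core using (_≡_)
open import Relation.Nullary.Decidable.Core using (does)
open import Relation.Nullary.Negation.Core using (¬_)
import Data.Integer.Properties as ℤ

BoolFun : ℕ → Set
BoolFun m = Vec Bool m → Bool

Monotone : ∀ {m} → BoolFun m → Set
Monotone f = ∀ {x y} → Pointwise Bool._≤_ x y → f x Bool.≤ f y

-- n log n = log (n ^ n) exactly, so this is n log n rounded up (and 0 for
-- n = 0, since 0 ^ 0 = 1).
⌈_log_⌉ : ℕ → ℕ → ℕ
⌈ n log m ⌉ = ⌈log₂ (m ^ n) ⌉

------------------------------------------------------------------------
-- Circuits

record Basis : Set₁ where
  field
    Input     : ℕ → Set          -- labels of input nodes, over m variables
    Gate      : Set              -- labels of gates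
    readInput : ∀ {m} → Vec Bool m → Input m → Bool
    applyGate : Gate → List⁺ Bool → Bool

module _ (B : Basis) where
  open Basis B

  -- A node of a circuit with k gates.  Input nodes are identified with their
  -- labels: merging equally labelled ones affects neither size nor depth.
  data Node (m k : ℕ) : Set where
    input : Input m → Node m k
    gate  : Fin k → Node m k

  -- A directed acyclic graph with k gates, listed in a topological order.
  -- As in de Bruijn notation, gate zero is the most recent one.  A gate
  -- carries the nonempty list of tails of its incoming wires; repetitions
  -- are multiple wires.
  data Gates (m : ℕ) : ℕ → Set where
    []    : Gates m zero
    _▷_∙_ : ∀ {k} → Gates m k → Gate → List⁺ (Node m k) → Gates m (suc k)

  record Circuit (m : ℕ) : Set where
    constructor circuit
    field
      {#gates} : ℕ
      gates    : Gates m #gates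
      output   : Node m #gates

module _ {B : Basis} where
  open Basis B

  module _ {m : ℕ} {A : Set} (onInput : Input m → A) (onGate : Gate → List⁺ A → A) where

    atNode : ∀ {k} → Vec A k → Node B m k → A
    atNode as (input ℓ) = onInput ℓ
    atNode as (gate i)  = lookup as i

    atGates : ∀ {k} → Gates B m k → Vec A k
    atGates []             = []
    atGates (gs ▷ op ∙ ws) = onGate op (List⁺.map (atNode (atGates gs)) ws) ∷ atGates gs

    atOutput : Circuit B m → A
    atOutput (circuit gs out) = atNode (atGates gs) out

  eval : ∀ {m} → Circuit B m → BoolFun m
  eval C x = atOutput (readInput x) applyGate C

  -- The maximum number of gates on a directed path from an input node to
  -- the output node.
  depth : ∀ {m} → Circuit B m → ℕ
  depth = atOutput (λ _ → 0) (λ _ ds → suc (foldr₁ _⊔_ ds))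

  #wires : ∀ {m k} → Gates B m k → ℕ
  #wires []            = 0
  #wires (gs ▷ _ ∙ ws) = List⁺.length ws + #wires gs

  size : ∀ {m} → Circuit B m → ℕ
  size C = #wires (Circuit.gates C)

  HasOutgoingWire : ∀ {m k} → Gates B m k → Fin k → Set
  HasOutgoingWire (gs ▷ _ ∙ ws) zero    = ⊥
  HasOutgoingWire (gs ▷ _ ∙ ws) (suc i) = gate i ∈ toList ws ⊎ HasOutgoingWire gs i

  OutputIsOnlySink : ∀ {m} → Circuit B m → Set
  OutputIsOnlySink (circuit gs out) = ∀ i → (out ≡ gate i) ⇔ (¬ HasOutgoingWire gs i)

  _Computes_ : ∀ {m} → Circuit B m → BoolFun m → Set
  C Computes f = ∀ x → eval C x ≡ f x

------------------------------------------------------------------------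
-- AND/OR/NOT circuits

-- NOT is applied to variables only and does not count towards depth, so it
-- is part of the input labels.
data Literal (m : ℕ) : Set where
  const   : Bool → Literal m
  pos neg : Fin m → Literal m

readLiteral : ∀ {m} → Vec Bool m → Literal m → Bool
readLiteral x (const b) = b
readLiteral x (pos i)   = lookup x i
readLiteral x (neg i)   = not (lookup x i)

data AndOr : Set where
  AND OR : AndOr

applyAndOr : AndOr → List⁺ Bool → Bool
applyAndOr AND bs = and (toList bs)
applyAndOr OR  bs = or (toList bs)

AndOrNot : Basis
AndOrNot = record
  { Input     = Literal
  ; Gate      = AndOr
  ; readInput = readLiteral
  ; applyGate = applyAndOr
  }

-- Size is measured in wires, which bounds the number of gates; an upper bound
-- on it is therefore at least as strong as one on the number of gates.
HasPolySizeDepth : ℕ → {N : ℕ → ℕ} → (ℕ → ℕ) → (∀ n → BoolFun (N n)) → Set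
HasPolySizeDepth d {N} p f =
  ∃[ c ] ∀ n → Σ[ C ∈ Circuit AndOrNot (N n) ]
    C Computes f n × depth C ≤ d × size C ≤ p n ^ c + c

-- Polynomial size here is polynomial in the number N n of input bits.
AC⁰ : {N : ℕ → ℕ} → (∀ n → BoolFun (N n)) → Set
AC⁰ {N} f = ∃[ d ] HasPolySizeDepth d N f

------------------------------------------------------------------------
-- Monotone majority circuits

data MonotoneInput (m : ℕ) : Set where
  const : Bool → MonotoneInput m
  var   : Fin m → MonotoneInput m

readMonotoneInput : ∀ {m} → Vec Bool m → MonotoneInput m → Bool
readMonotoneInput x (const b) = b
readMonotoneInput x (var i)   = lookup x i

THR : ℤ → List⁺ Bool → Bool
THR t bs = does (t ℤ.≤? ℤ.+ length (filterᵇ id (toList bs)))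

Threshold : Basis
Threshold = record
  { Input     = MonotoneInput
  ; Gate      = ℤ
  ; readInput = readMonotoneInput
  ; applyGate = THR
  }

record MonotoneMajorityCircuit (m : ℕ) : Set where
  field
    underlying       : Circuit Threshold m
    outputIsOnlySink : OutputIsOnlySink underlying

open MonotoneMajorityCircuit public using (underlying)

------------------------------------------------------------------------
-- Growth

-- s ≥ 2 ^ r for the real number r = n ^ (1/d) / k ≥ 0 (d, k ≥ 1), i.e.
-- s ≥ 2 ^ (p / q) for every rational p / q ≤ r.
AtLeast2^Root : (k d n s : ℕ) → Set
AtLeast2^Root k d n s =
  ∀ p q → .{{NonZero q}} → (k * p) ^ d ≤ n * q ^ d → 2 ^ p ≤ s ^ q

-- Every depth-d circuit for f n has size 2 ^ Ω(n ^ (1/d)).  It suffices to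
-- let the constant in Ω range over the unit fractions 1 / k.
MajorityLowerBound : ℕ → {N : ℕ → ℕ} → (∀ n → BoolFun (N n)) → Set
MajorityLowerBound d {N} f =
  ∃[ k ] NonZero k × (∃[ n₀ ] (∀ n → n₀ ≤ n →
    (C : MonotoneMajorityCircuit (N n)) → underlying C Computes f n →
    depth (underlying C) ≤ d → AtLeast2^Root k d n (size (underlying C))))

{-# OPTIONS --safe #-}

-- Let B grow slowly with n.  g n reads its input as n columns of bits and
-- accepts iff Σ fᵢ B ^ (n - i) ≥ B ^ n, where fᵢ is the number of ones in the
-- i-th column.  Reading the columns from the most significant one on, the
-- deficit is determined modulo B by the latest column, and it can no longer be
-- made up once it exceeds B.  So g n is an OR, over the column at which it
-- accepts, of an AND of predicates of two adjacent columns, and these have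
-- small CNFs.
--
-- For the lower bound, each depth t gets a list of triples (Y, Z, N) of blocks
-- of columns: Z preserves the deficit, Y decreases and N increases it, but a
-- small circuit of depth t rarely tells Y from Z or Z from N.  To pass from t
-- to t + 1, compare Z…ZY0…0 with Z…ZN1…1, where Y and N stand at the same
-- random position.  Call a child of the output gate live after a prefix Z…Z if
-- it is not yet determined: 0 on Z…Z0…0, but 1 on Z…Z1…1.  If the gate is
-- right at a position, then fewer children are live afterwards than err there,
-- which on average is a small fraction of those live before.  This can happen
-- only about log₂ (size) times, hence at few of the positions.

module Submission where

open import Defs
open import Data.Bool.Base using (Bool; true; false; _∧_; _∨_; if_then_else_; T; b≤b; f≤t)
  renaming (_≤_ to _≤ᴮ_)
open import Data.Bool.ListAction using (and; or)
import Data.Bool.Properties as Bool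
open import Data.Fin.Base using (Fin; zero; suc; toℕ; _↑ˡ_; _↑ʳ_)
open import Data.Fin.Properties using (toℕ-injective; suc-injective; ↑ˡ-injective; ↑ʳ-injective)
import Data.Integer.Base as ℤ
import Data.Integer.Properties as ℤ
open import Data.List.Base as List using (List; []; _∷_; _++_; length; concatMap; take; drop; filterᵇ)
import Data.List.NonEmpty.Base as List⁺
open import Data.List.NonEmpty.Base using (List⁺; _∷_; toList; foldr₁)
open import Data.List.Properties
  using (++-assoc; ++-identityʳ; length-++; length-map; length-tabulate; length-replicate; length-take;
         map-++; take-map; drop-map)
open import Data.List.Relation.Binary.Pointwise as Pointwise using (Pointwise; []; _∷_)
open import Data.List.Relation.Unary.All as All using (All; []; _∷_)
import Data.List.Relation.Unary.All.Properties as All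
open import Data.Nat.Base
open import Data.Nat.DivMod using (_%_; _/_; m≡m%n+[m/n]*n; m%n<n)
open import Data.Nat.Logarithm using (⌈log₂_⌉; ⌈log₂⌉-mono-≤; ⌈log₂2^n⌉≡n)
open import Data.Nat.Properties hiding (suc-injective)
open import Data.Nat.Tactic.RingSolver using (solve-∀)
open import Data.Product.Base using (Σ-syntax; ∃-syntax; _×_; _,_; proj₁; proj₂)
open import Data.Sum.Base using (_⊎_; inj₁; inj₂)
open import Data.Vec.Base as Vec using (Vec; []; _∷_; _[_]≔_)
open import Data.Vec.Properties using (toList-++; toList-map; toList-replicate; length-toList; map-lookup-allFin)
open import Data.Vec.Relation.Binary.Pointwise.Inductive as VecPointwise using ([]; _∷_)
open import Function.Base using (_∘_; id)
open import Relation.Binary.PropositionalEquality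
open import Relation.Nullary.Decidable.Core using (yes; no; does)
open import Relation.Nullary.Negation using (contradiction)

private variable
  A A′ : Set

-- Sums over lists

∑ : List A → (A → ℕ) → ℕ
∑ []       f = 0
∑ (x ∷ xs) f = f x + ∑ xs f

∑-cong : (xs : List A) {f g : A → ℕ} → (∀ x → f x ≡ g x) → ∑ xs f ≡ ∑ xs g
∑-cong []       f≡g = refl
∑-cong (x ∷ xs) f≡g = cong₂ _+_ (f≡g x) (∑-cong xs f≡g)

∑-mono : (xs : List A) {f g : A → ℕ} → (∀ x → f x ≤ g x) → ∑ xs f ≤ ∑ xs g
∑-mono []       f≤g = z≤n
∑-mono (x ∷ xs) f≤g = +-mono-≤ (f≤g x) (∑-mono xs f≤g)

∑-All-mono : {xs : List A} {f g : A → ℕ} → All (λ x → f x ≤ g x) xs → ∑ xs f ≤ ∑ xs g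
∑-All-mono []           = z≤n
∑-All-mono (fx≤gx ∷ f≤g) = +-mono-≤ fx≤gx (∑-All-mono f≤g)

∑-+ : (xs : List A) (f g : A → ℕ) → ∑ xs (λ x → f x + g x) ≡ ∑ xs f + ∑ xs g
∑-+ []       f g = refl
∑-+ (x ∷ xs) f g rewrite ∑-+ xs f g = lemma (f x) (g x) (∑ xs f) (∑ xs g)
  where
  lemma : ∀ a b c d → a + b + (c + d) ≡ a + c + (b + d)
  lemma = solve-∀

∑-* : (xs : List A) (k : ℕ) (f : A → ℕ) → ∑ xs (λ x → k * f x) ≡ k * ∑ xs f
∑-* []       k f = sym (*-zeroʳ k)
∑-* (x ∷ xs) k f rewrite ∑-* xs k f = sym (*-distribˡ-+ k (f x) (∑ xs f))

∑-const : (xs : List A) (k : ℕ) → ∑ xs (λ _ → k) ≡ length xs * k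
∑-const []       k = refl
∑-const (x ∷ xs) k = cong (k +_) (∑-const xs k)

∑-++ : (xs ys : List A) (f : A → ℕ) → ∑ (xs ++ ys) f ≡ ∑ xs f + ∑ ys f
∑-++ []       ys f = refl
∑-++ (x ∷ xs) ys f rewrite ∑-++ xs ys f = sym (+-assoc (f x) _ _)

∑-map : (h : A → A′) (xs : List A) (f : A′ → ℕ) → ∑ (List.map h xs) f ≡ ∑ xs (f ∘ h)
∑-map h []       f = refl
∑-map h (x ∷ xs) f = cong (f (h x) +_) (∑-map h xs f)

∑-concatMap : (h : A → List A′) (xs : List A) (f : A′ → ℕ) →
  ∑ (concatMap h xs) f ≡ ∑ xs (λ x → ∑ (h x) f)
∑-concatMap h []       f = refl
∑-concatMap h (x ∷ xs) f =
  trans (∑-++ (h x) (concatMap h xs) f) (cong (∑ (h x) f +_) (∑-concatMap h xs f))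

∑-replicate : (k : ℕ) (x : A) (f : A → ℕ) → ∑ (List.replicate k x) f ≡ k * f x
∑-replicate zero    x f = refl
∑-replicate (suc k) x f = cong (f x +_) (∑-replicate k x f)

∑-swap : (xs : List A) (ys : List A′) (f : A → A′ → ℕ) →
  ∑ xs (λ x → ∑ ys (f x)) ≡ ∑ ys (λ y → ∑ xs (λ x → f x y))
∑-swap []       ys f = sym (trans (∑-const ys 0) (*-zeroʳ (length ys)))
∑-swap (x ∷ xs) ys f =
  trans (cong (∑ ys (f x) +_) (∑-swap xs ys f)) (sym (∑-+ ys (f x) _))

length≡∑1 : (xs : List A) → length xs ≡ ∑ xs (λ _ → 1)
length≡∑1 xs = sym (trans (∑-const xs 1) (*-identityʳ _))

-- Truth values as numbers

⟦_⟧ : Bool → ℕ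
⟦ true  ⟧ = 1
⟦ false ⟧ = 0

-- The truncated difference of two bits. It records that a function tells one block from another,
-- and that a child is live between the all-zero and the all-one completion.
beats : Bool → Bool → ℕ
beats true  false = 1
beats true  true  = 0
beats false _     = 0

beats≤1 : ∀ p q → beats p q ≤ 1
beats≤1 true  true  = z≤n
beats≤1 true  false = ≤-refl
beats≤1 false _     = z≤n

beats-mono : ∀ {p p′ q q′} → p ≤ᴮ p′ → q′ ≤ᴮ q → beats p q ≤ beats p′ q′
beats-mono {false} _   _   = z≤n
beats-mono {true}  {q = true}              b≤b _   = z≤n
beats-mono {true}  {q = false} {q′ = false} b≤b _   = ≤-refl

-- (u′ - ℓ′) + y - n = (y - ℓ′) + (u′ - n); if ℓ ≡ u, everything is equal.
beats-telescope : ∀ {ℓ u ℓ′ u′ y n} → ℓ ≤ᴮ ℓ′ → ℓ′ ≤ᴮ u′ → u′ ≤ᴮ u → ℓ ≤ᴮ y → y ≤ᴮ u → ℓ ≤ᴮ n → n ≤ᴮ u →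
  beats u′ ℓ′ + ⟦ y ⟧ ≤ ⟦ n ⟧ + beats u ℓ * (beats y ℓ′ + beats u′ n)
beats-telescope {true}                                         b≤b b≤b b≤b b≤b b≤b b≤b b≤b = ≤-refl
beats-telescope {false} {false}                                b≤b b≤b b≤b b≤b b≤b b≤b b≤b = z≤n
beats-telescope {false} {true} {true}  {true}  {true}  {true}  _ _ _ _ _ _ _ = s≤s z≤n
beats-telescope {false} {true} {true}  {true}  {true}  {false} _ _ _ _ _ _ _ = s≤s z≤n
beats-telescope {false} {true} {true}  {true}  {false} {_}     _ _ _ _ _ _ _ = z≤n
beats-telescope {false} {true} {false} {true}  {true}  {true}  _ _ _ _ _ _ _ = s≤s (s≤s z≤n)
beats-telescope {false} {true} {false} {true}  {true}  {false} _ _ _ _ _ _ _ = s≤s (s≤s z≤n)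
beats-telescope {false} {true} {false} {true}  {false} {true}  _ _ _ _ _ _ _ = s≤s z≤n
beats-telescope {false} {true} {false} {true}  {false} {false} _ _ _ _ _ _ _ = s≤s z≤n
beats-telescope {false} {true} {false} {false} {true}  {true}  _ _ _ _ _ _ _ = s≤s z≤n
beats-telescope {false} {true} {false} {false} {true}  {false} _ _ _ _ _ _ _ = s≤s z≤n
beats-telescope {false} {true} {false} {false} {false} {_}     _ _ _ _ _ _ _ = z≤n

-- Blocks of columns and their contexts

Block : ℕ → ℕ → Set
Block r L = Vec (Vec Bool r) L

const-block : ∀ {r L} → Bool → Block r L
const-block b = Vec.replicate _ (Vec.replicate _ b)

infix 4 _≼_

_≼_ : List Bool → List Bool → Set
_≼_ = Pointwise _≤ᴮ_

≼-refl : ∀ xs → xs ≼ xs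
≼-refl _ = Pointwise.refl Bool.≤-refl

++-monoʳ-≼ : ∀ p {xs ys} → xs ≼ ys → p ++ xs ≼ p ++ ys
++-monoʳ-≼ p = Pointwise.++⁺ (≼-refl p)

++-monoˡ-≼ : ∀ q {xs ys} → xs ≼ ys → xs ++ q ≼ ys ++ q
++-monoˡ-≼ q xs≼ys = Pointwise.++⁺ xs≼ys (≼-refl q)

-- Every column of the block is extended by the same further rows w.
flat : ∀ {r L} → List Bool → Block r L → List Bool
flat w []       = []
flat w (c ∷ cs) = Vec.toList c ++ w ++ flat w cs

flat-++ : ∀ {r L L′} w (x : Block r L) (y : Block r L′) → flat w (x Vec.++ y) ≡ flat w x ++ flat w y
flat-++ w []       y = refl
flat-++ w (c ∷ x) y = begin
  Vec.toList c ++ w ++ flat w (x Vec.++ y)       ≡⟨ cong (λ z → Vec.toList c ++ w ++ z) (flat-++ w x y) ⟩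
  Vec.toList c ++ w ++ flat w x ++ flat w y      ≡⟨ cong (Vec.toList c ++_) (++-assoc w (flat w x) (flat w y)) ⟨
  Vec.toList c ++ (w ++ flat w x) ++ flat w y    ≡⟨ ++-assoc (Vec.toList c) _ _ ⟨
  (Vec.toList c ++ w ++ flat w x) ++ flat w y    ∎
  where open ≡-Reasoning

extend : ∀ {r L s} → Vec Bool s → Block r L → Block (r + s) L
extend u = Vec.map (Vec._++ u)

flat-extend : ∀ {r L s} w (u : Vec Bool s) (x : Block r L) → flat w (extend u x) ≡ flat (Vec.toList u ++ w) x
flat-extend w u []      = refl
flat-extend w u (c ∷ x) = begin
  Vec.toList (c Vec.++ u) ++ w ++ flat w (extend u x)
    ≡⟨ cong₂ (λ a b → a ++ w ++ b) (toList-++ c u) (flat-extend w u x) ⟩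
  (Vec.toList c ++ Vec.toList u) ++ w ++ flat (Vec.toList u ++ w) x
    ≡⟨ ++-assoc (Vec.toList c) _ _ ⟩
  Vec.toList c ++ Vec.toList u ++ w ++ flat (Vec.toList u ++ w) x
    ≡⟨ cong (Vec.toList c ++_) (++-assoc (Vec.toList u) w _) ⟨
  Vec.toList c ++ (Vec.toList u ++ w) ++ flat (Vec.toList u ++ w) x ∎
  where open ≡-Reasoning

zeros-minimum : ∀ {r} (c : Vec Bool r) → Vec.toList (Vec.replicate r false) ≼ Vec.toList c
zeros-minimum []      = []
zeros-minimum (b ∷ c) = Bool.≤-minimum b ∷ zeros-minimum c

ones-maximum : ∀ {r} (c : Vec Bool r) → Vec.toList c ≼ Vec.toList (Vec.replicate r true)
ones-maximum []      = []
ones-maximum (b ∷ c) = Bool.≤-maximum b ∷ ones-maximum c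

flat-minimum : ∀ {r L} w (x : Block r L) → flat {r} {L} w (const-block false) ≼ flat w x
flat-minimum w []      = []
flat-minimum w (c ∷ x) = Pointwise.++⁺ (zeros-minimum c) (++-monoʳ-≼ w (flat-minimum w x))

flat-maximum : ∀ {r L} w (x : Block r L) → flat w x ≼ flat {r} {L} w (const-block true)
flat-maximum w []      = []
flat-maximum w (c ∷ x) = Pointwise.++⁺ (ones-maximum c) (++-monoʳ-≼ w (flat-maximum w x))

-- The family is closed under fixing neighbouring columns and under fixing lower rows of a block.
-- Hence a triple inside a larger block again stands in a context, as the recursion over depth
-- requires.
record IsContext {r L} (κ : Block r L → List Bool) : Set where
  constructor context
  field
    before rows-below after : List Bool
    shape : ∀ x → κ x ≡ before ++ flat rows-below x ++ after

module _ {r L} {κ : Block r L → List Bool} (ctx : IsContext κ) where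
  open IsContext ctx

  context-minimum : ∀ x → κ (const-block false) ≼ κ x
  context-minimum x rewrite shape x | shape (const-block false) =
    ++-monoʳ-≼ before (++-monoˡ-≼ after (flat-minimum rows-below x))

  context-maximum : ∀ x → κ x ≼ κ (const-block true)
  context-maximum x rewrite shape x | shape (const-block true) =
    ++-monoʳ-≼ before (++-monoˡ-≼ after (flat-maximum rows-below x))

context-∷ʳ : ∀ {r L L′} {κ : Block r (L + L′) → List Bool} → IsContext κ →
  (y : Block r L′) → IsContext (λ x → κ (x Vec.++ y))
context-∷ʳ (context p w q shape) y = context p w (flat w y ++ q) λ x →
  trans (shape (x Vec.++ y)) (cong (p ++_) (trans (cong (_++ q) (flat-++ w x y)) (++-assoc (flat w x) _ _)))

context-∷ˡ : ∀ {r L L′} {κ : Block r (L + L′) → List Bool} → IsContext κ →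
  (x : Block r L) → IsContext (λ y → κ (x Vec.++ y))
context-∷ˡ (context p w q shape) x = context (p ++ flat w x) w q λ y →
  trans (shape (x Vec.++ y)) (trans
    (cong (p ++_) (trans (cong (_++ q) (flat-++ w x y)) (++-assoc (flat w x) _ _)))
    (sym (++-assoc p _ _)))

context-extend : ∀ {r s L} {κ : Block (r + s) L → List Bool} → IsContext κ →
  (u : Vec Bool s) → IsContext (λ x → κ (extend u x))
context-extend (context p w q shape) u = context p (Vec.toList u ++ w) q λ x →
  trans (shape (extend u x)) (cong (λ z → p ++ z ++ q) (flat-extend w u x))

-- The halving argument

record Triple (r L : ℕ) : Set where
  constructor triple
  field
    Y Z N : Block r L

open Triple

-- The repetitions give all m positions in half Ω m the same weight.
half : ∀ {r L} → List (Triple r L) → (j : ℕ) → List (Block r (j * L) × Block r (j * L))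
half Ω zero    = []
half Ω (suc j) =
  concatMap (λ ω → List.replicate (length Ω ^ j) (Y ω Vec.++ const-block false , N ω Vec.++ const-block true)) Ω
  ++ concatMap (λ ω → List.map (λ p → Z ω Vec.++ proj₁ p , Z ω Vec.++ proj₂ p) (half Ω j)) Ω

∑-half-suc : ∀ {r L} (Ω : List (Triple r L)) j f → ∑ (half Ω (suc j)) f ≡
  length Ω ^ j * ∑ Ω (λ ω → f (Y ω Vec.++ const-block false , N ω Vec.++ const-block true))
  + ∑ Ω (λ ω → ∑ (half Ω j) (λ p → f (Z ω Vec.++ proj₁ p , Z ω Vec.++ proj₂ p)))
∑-half-suc Ω j f = trans (∑-++ (concatMap _ Ω) _ f) (cong₂ _+_
  (trans (∑-concatMap _ Ω f) (trans (∑-cong Ω λ ω → ∑-replicate (length Ω ^ j) _ f) (∑-* Ω (length Ω ^ j) _)))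
  (trans (∑-concatMap _ Ω f) (∑-cong Ω λ ω → ∑-map _ (half Ω j) f)))

length-half : ∀ {r L} (Ω : List (Triple r L)) j → length (half Ω j) ≡ j * length Ω ^ j
length-half Ω zero    = refl
length-half Ω (suc j) = begin
  length (half Ω (suc j))                       ≡⟨ length≡∑1 (half Ω (suc j)) ⟩
  ∑ (half Ω (suc j)) (λ _ → 1)                  ≡⟨ ∑-half-suc Ω j _ ⟩
  q ^ j * ∑ Ω (λ _ → 1) + ∑ Ω (λ _ → ∑ (half Ω j) (λ _ → 1))
    ≡⟨ cong₂ (λ a b → q ^ j * a + b) (sym (length≡∑1 Ω))
         (trans (∑-const Ω _) (cong (q *_) (trans (sym (length≡∑1 (half Ω j))) (length-half Ω j)))) ⟩
  q ^ j * q + q * (j * q ^ j)                   ≡⟨ lemma q (q ^ j) j ⟩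
  suc j * q ^ suc j                             ∎
  where
  open ≡-Reasoning
  q = length Ω
  lemma : ∀ q p j → p * q + q * (j * p) ≡ q * p + j * (q * p)
  lemma = solve-∀

-- For every a, J / 2 ^ a + a bounds the logarithmic potential log₂ J from above
-- (up to a constant).  Where γ is frequent enough, J′ is at most J / 2 on
-- average, so the bound for J follows from that for J′ with a decreased by 1.
drift : (Ω : List A) (γ F J′ G : A → ℕ) (J X v P w : ℕ) →
  (∀ ω → γ ω ≤ 1) → (∀ ω → γ ω ≡ 1 → 1 + J′ ω ≤ F ω) → (∀ ω → J′ ω ≤ J) →
  X * ∑ Ω F ≤ 2 * (v * length Ω) * J →
  (∀ ω a → X * (2 ^ a * G ω) ≤ P * (X * (2 ^ a * a + J′ ω) + 2 ^ a * w)) →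
  ∀ a → X * (2 ^ a * (P * ∑ Ω γ + ∑ Ω G)) ≤ length Ω * P * (X * (2 ^ a * a + J) + 2 ^ a * (4 * v + w))
drift Ω γ F J′ G J X v P w γ≤1 gain J′≤J ∑F≤ IH a with ≤-total (4 * (v * length Ω)) (X * ∑ Ω γ)
-- Rare wins are charged to `4 * v`; the potential need not drop.
... | inj₂ few = begin
  X * (2 ^ a * (P * ∑ Ω γ + ∑ Ω G))
    ≡⟨ lemma₁ X (2 ^ a) P (∑ Ω γ) (∑ Ω G) ⟩
  2 ^ a * P * (X * ∑ Ω γ) + X * (2 ^ a * ∑ Ω G)
    ≤⟨ +-mono-≤ (*-monoʳ-≤ (2 ^ a * P) few) G≤ ⟩
  2 ^ a * P * (4 * (v * length Ω)) + length Ω * (P * (X * (2 ^ a * a + J) + 2 ^ a * w))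
    ≡⟨ lemma₂ (2 ^ a) P v (length Ω) (X * (2 ^ a * a + J)) w ⟩
  length Ω * P * (X * (2 ^ a * a + J) + 2 ^ a * (4 * v + w)) ∎
  where
  open ≤-Reasoning
  lemma₁ : ∀ X M P g G → X * (M * (P * g + G)) ≡ M * P * (X * g) + X * (M * G)
  lemma₁ = solve-∀
  lemma₂ : ∀ M P v q K w → M * P * (4 * (v * q)) + q * (P * (K + M * w)) ≡ q * P * (K + M * (4 * v + w))
  lemma₂ = solve-∀
  G≤ : X * (2 ^ a * ∑ Ω G) ≤ length Ω * (P * (X * (2 ^ a * a + J) + 2 ^ a * w))
  G≤ = begin
    X * (2 ^ a * ∑ Ω G)                 ≡⟨ *-assoc X (2 ^ a) _ ⟨
    X * 2 ^ a * ∑ Ω G                   ≡⟨ ∑-* Ω (X * 2 ^ a) G ⟨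
    ∑ Ω (λ ω → X * 2 ^ a * G ω)         ≤⟨ ∑-mono Ω (λ ω → ≤-trans (≤-reflexive (*-assoc X (2 ^ a) _)) (≤-trans (IH ω a)
                                             (*-monoʳ-≤ P (+-monoˡ-≤ _ (*-monoʳ-≤ X (+-monoʳ-≤ _ (J′≤J ω))))))) ⟩
    ∑ Ω (λ _ → P * (X * (2 ^ a * a + J) + 2 ^ a * w)) ≡⟨ ∑-const Ω _ ⟩
    length Ω * (P * (X * (2 ^ a * a + J) + 2 ^ a * w)) ∎
-- The summand `P * J * (X * ∑ Ω γ)`, added on both sides, pays for the errors:
-- `2 * P * (X * ∑ Ω F)` is at most `P * J * (4 * (v * length Ω))`, which by `many` is at most that
-- summand.
... | inj₁ many = +-cancelʳ-≤ (P * J * (X * ∑ Ω γ)) _ _ (begin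
  X * (2 ^ a * (P * ∑ Ω γ + ∑ Ω G)) + P * J * (X * ∑ Ω γ)
    ≡⟨ lemma₁ X (2 ^ a) P (∑ Ω γ) (∑ Ω G) J ⟩
  (X * 2 ^ a * P + P * J * X) * ∑ Ω γ + X * 2 ^ a * ∑ Ω G
    ≡⟨ cong₂ _+_ (∑-* Ω (X * 2 ^ a * P + P * J * X) γ) (∑-* Ω (X * 2 ^ a) G) ⟨
  ∑ Ω (λ ω → (X * 2 ^ a * P + P * J * X) * γ ω) + ∑ Ω (λ ω → X * 2 ^ a * G ω)
    ≡⟨ ∑-+ Ω _ _ ⟨
  ∑ Ω (λ ω → (X * 2 ^ a * P + P * J * X) * γ ω + X * 2 ^ a * G ω)
    ≤⟨ ∑-mono Ω (λ ω → pointwise a ω (γ ω) refl) ⟩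
  ∑ Ω (λ ω → P * (X * (2 ^ a * a + J) + 2 ^ a * w) + 2 * P * X * F ω)
    ≡⟨ ∑-+ Ω _ _ ⟩
  ∑ Ω (λ ω → P * (X * (2 ^ a * a + J) + 2 ^ a * w)) + ∑ Ω (λ ω → 2 * P * X * F ω)
    ≡⟨ cong₂ _+_ (∑-const Ω _) (trans (∑-* Ω (2 * P * X) F) (*-assoc (2 * P) X _)) ⟩
  length Ω * (P * (X * (2 ^ a * a + J) + 2 ^ a * w)) + 2 * P * (X * ∑ Ω F)
    ≤⟨ +-monoʳ-≤ _ (*-monoʳ-≤ (2 * P) ∑F≤) ⟩
  length Ω * (P * (X * (2 ^ a * a + J) + 2 ^ a * w)) + 2 * P * (2 * (v * length Ω) * J)
    ≡⟨ lemma₂ (length Ω) P (X * (2 ^ a * a + J)) (2 ^ a * w) v J ⟩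
  length Ω * P * (X * (2 ^ a * a + J) + 2 ^ a * w) + P * J * (4 * (v * length Ω))
    ≤⟨ +-mono-≤ (*-monoʳ-≤ (length Ω * P) (+-monoʳ-≤ (X * (2 ^ a * a + J)) (*-monoʳ-≤ (2 ^ a) (m≤n+m w (4 * v)))))
                (*-monoʳ-≤ (P * J) many) ⟩
  length Ω * P * (X * (2 ^ a * a + J) + 2 ^ a * (4 * v + w)) + P * J * (X * ∑ Ω γ) ∎)
  where
  open ≤-Reasoning
  lemma₁ : ∀ X M P g G J → X * (M * (P * g + G)) + P * J * (X * g) ≡ (X * M * P + P * J * X) * g + X * M * G
  lemma₁ = solve-∀
  lemma₂ : ∀ q P K w v J → q * (P * (K + w)) + 2 * P * (2 * (v * q) * J) ≡ q * P * (K + w) + P * J * (4 * (v * q))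
  lemma₂ = solve-∀
  lemma₃ : ∀ X M P J a j w → (X * M * P + P * J * X) * 1 + P * (X * (M * a + j) + M * w)
                             ≡ P * (X * (M * a + (J + (M + j))) + M * w)
  lemma₃ = solve-∀
  lemma₄ : ∀ X M P J a j w → (X * (2 * M) * P + P * J * X) * 1 + 2 * (P * (X * (M * a + j) + M * w))
                             ≡ P * (X * (2 * M * (1 + a) + (J + 2 * j)) + 2 * M * w)
  lemma₄ = solve-∀
  lemma₅ : ∀ P X K J F W → P * (X * (K + (J + 2 * F)) + W) ≡ P * (X * (K + J) + W) + 2 * P * X * F
  lemma₅ = solve-∀
  pointwise : ∀ a ω g → γ ω ≡ g → (X * 2 ^ a * P + P * J * X) * γ ω + X * 2 ^ a * G ω
              ≤ P * (X * (2 ^ a * a + J) + 2 ^ a * w) + 2 * P * X * F ω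
  pointwise a ω 0 γ≡0 rewrite γ≡0 | *-zeroʳ (X * 2 ^ a * P + P * J * X) = begin
    X * 2 ^ a * G ω                                 ≡⟨ *-assoc X (2 ^ a) _ ⟩
    X * (2 ^ a * G ω)                               ≤⟨ IH ω a ⟩
    P * (X * (2 ^ a * a + J′ ω) + 2 ^ a * w)        ≤⟨ *-monoʳ-≤ P (+-monoˡ-≤ _ (*-monoʳ-≤ X (+-monoʳ-≤ _ (J′≤J ω)))) ⟩
    P * (X * (2 ^ a * a + J) + 2 ^ a * w)           ≤⟨ m≤m+n _ _ ⟩
    P * (X * (2 ^ a * a + J) + 2 ^ a * w) + 2 * P * X * F ω ∎
  -- Here `a` cannot decrease; the unit in `1 + J′ ω ≤ F ω` pays for the win instead.
  pointwise zero ω 1 γ≡1 rewrite γ≡1 = begin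
    (X * 1 * P + P * J * X) * 1 + X * 1 * G ω       ≡⟨ cong ((X * 1 * P + P * J * X) * 1 +_) (*-assoc X 1 _) ⟩
    (X * 1 * P + P * J * X) * 1 + X * (1 * G ω)     ≤⟨ +-monoʳ-≤ ((X * 1 * P + P * J * X) * 1) (IH ω 0) ⟩
    (X * 1 * P + P * J * X) * 1 + P * (X * (1 * 0 + J′ ω) + 1 * w) ≡⟨ lemma₃ X 1 P J 0 (J′ ω) w ⟩
    P * (X * (1 * 0 + (J + (1 + J′ ω))) + 1 * w)
      ≤⟨ *-monoʳ-≤ P (+-monoˡ-≤ (1 * w) (*-monoʳ-≤ X (+-monoʳ-≤ (1 * 0) (+-monoʳ-≤ J (≤-trans (gain ω γ≡1) (m≤n*m (F ω) 2)))))) ⟩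
    P * (X * (1 * 0 + (J + 2 * F ω)) + 1 * w)       ≡⟨ lemma₅ P X (1 * 0) J (F ω) (1 * w) ⟩
    P * (X * (1 * 0 + J) + 1 * w) + 2 * P * X * F ω ∎
  -- In the term with `a`, twice the hypothesis at `a` leaves `2 ^ suc a` free, which is exactly the
  -- weight of the win.
  pointwise (suc a) ω 1 γ≡1 rewrite γ≡1 = begin
    c * 1 + X * (2 * 2 ^ a) * G ω                   ≡⟨ cong (c * 1 +_) (lemma₆ X (2 ^ a) (G ω)) ⟩
    c * 1 + 2 * (X * (2 ^ a * G ω))                 ≤⟨ +-monoʳ-≤ (c * 1) (*-monoʳ-≤ 2 (IH ω a)) ⟩
    c * 1 + 2 * (P * (X * (2 ^ a * a + J′ ω) + 2 ^ a * w)) ≡⟨ lemma₄ X (2 ^ a) P J a (J′ ω) w ⟩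
    P * (X * (2 ^ suc a * suc a + (J + 2 * J′ ω)) + 2 ^ suc a * w)
      ≤⟨ *-monoʳ-≤ P (+-monoˡ-≤ (2 ^ suc a * w) (*-monoʳ-≤ X (+-monoʳ-≤ (2 ^ suc a * suc a) (+-monoʳ-≤ J
           (*-monoʳ-≤ 2 (≤-trans (n≤1+n _) (gain ω γ≡1))))))) ⟩
    P * (X * (2 ^ suc a * suc a + (J + 2 * F ω)) + 2 ^ suc a * w) ≡⟨ lemma₅ P X (2 ^ suc a * suc a) J (F ω) _ ⟩
    P * (X * (2 ^ suc a * suc a + J) + 2 ^ suc a * w) + 2 * P * X * F ω ∎
    where
    c = X * (2 * 2 ^ a) * P + P * J * X
    lemma₆ : ∀ X M G → X * (2 * M) * G ≡ 2 * (X * (M * G))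
    lemma₆ = solve-∀
  pointwise a ω (suc (suc g)) γ≡ with s≤s () ← subst (_≤ 1) γ≡ (γ≤1 ω)

-- Confusion passes through threshold gates

Isotone : (List Bool → Bool) → Set
Isotone h = ∀ {xs ys} → xs ≼ ys → h xs ≤ᴮ h ys

-- A probability bound `v / X`, for a uniformly random member of `Ω`, with denominators cleared. The
-- context is fixed before the member is drawn.
Confuses : ℕ → ℕ → ∀ {r L} → (List Bool → Bool) → (Ω : List A) (x y : A → Block r L) → Set
Confuses X v h Ω x y = ∀ {κ} → IsContext κ →
  X * ∑ Ω (λ ω → beats (h (κ (x ω))) (h (κ (y ω)))) ≤ v * length Ω

record Confused (X v : ℕ) {r L} (Ω : List (Triple r L)) (h : List Bool → Bool) : Set where
  field
    isotone : Isotone h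
    Y-vs-Z  : Confuses X v h Ω Y Z
    Z-vs-N  : Confuses X v h Ω Z N

open Confused

count : List (List Bool → Bool) → List Bool → ℕ
count hs x = ∑ hs (λ h → ⟦ h x ⟧)

live : ∀ {r L} → List (List Bool → Bool) → (Block r L → List Bool) → ℕ
live hs κ = ∑ hs (λ h → beats (h (κ (const-block true))) (h (κ (const-block false))))

module _ {X v r L : ℕ} {Ω : List (Triple r L)}
  {hs : List (List Bool → Bool)} (confused : All (Confused X v Ω) hs)
  {h : List Bool → Bool} (thr : ∀ x y → count hs x ≤ count hs y → h x ≤ᴮ h y) where

  private
    Q = length Ω
    win : ∀ {j} → (Block r (j * L) → List Bool) → Block r (j * L) × Block r (j * L) → ℕ
    win κ p = beats (h (κ (proj₁ p))) (h (κ (proj₂ p)))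

  beats⇒count< : ∀ x y → beats (h x) (h y) ≡ 1 → count hs y < count hs x
  beats⇒count< x y hx>hy = ≰⇒> λ x≤y → absurd (thr x y x≤y) hx>hy
    where
    absurd : ∀ {p q} → p ≤ᴮ q → beats p q ≢ 1
    absurd {false} _   ()
    absurd {true}  b≤b ()

  -- Each position costs one use of `drift`: `γ` marks a win at the first position and `G` counts
  -- the wins later on, after `Z ω` has joined the context. The factor `Q ^ j` is the weight of each
  -- position in `half Ω j`.
  bound : ∀ j a {κ} → IsContext κ →
    X * (2 ^ a * ∑ (half Ω j) (win {j} κ)) ≤ Q ^ j * (X * (2 ^ a * a + live {r} {j * L} hs κ) + 2 ^ a * (j * (4 * v)))
  bound zero a {κ} ctx = ≤-trans (≤-reflexive (trans (cong (X *_) (*-zeroʳ (2 ^ a))) (*-zeroʳ X))) z≤n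
  bound (suc j) a {κ} ctx =
    subst (λ n → X * (2 ^ a * n) ≤ _) (sym (∑-half-suc Ω j _))
      (drift Ω γ F J′ G (live hs κ) X v (Q ^ j) (j * (4 * v)) (λ ω → beats≤1 (h (yω ω)) _) gain J′≤J ∑F≤
        (λ ω a → bound j a (context-∷ˡ ctx (Z ω))) a)
    where
    yω nω : Triple r L → List Bool
    yω ω = κ (Y ω Vec.++ const-block false)
    nω ω = κ (N ω Vec.++ const-block true)
    κ′ : Triple r L → Block r (j * L) → List Bool
    κ′ ω y = κ (Z ω Vec.++ y)
    γ F J′ G : Triple r L → ℕ
    γ ω = beats (h (yω ω)) (h (nω ω))
    J′ ω = live hs (κ′ ω)
    G ω = ∑ (half Ω j) (win {j} (κ′ ω))
    alive : (List Bool → Bool) → ℕ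
    alive h = beats (h (κ (const-block true))) (h (κ (const-block false)))
    error₀ error₁ errors : Triple r L → (List Bool → Bool) → ℕ
    error₀ ω h = beats (h (yω ω)) (h (κ′ ω (const-block false)))
    error₁ ω h = beats (h (κ′ ω (const-block true))) (h (nω ω))
    errors ω h = error₀ ω h + error₁ ω h
    F ω = ∑ hs (λ h → alive h * errors ω h)

    J′≤J : ∀ ω → J′ ω ≤ live hs κ
    J′≤J ω = ∑-All-mono (All.map (λ c → beats-mono (isotone c (context-maximum ctx _)) (isotone c (context-minimum ctx _))) confused)

    -- `beats-telescope` for each child, its bounds being the values at the all-zero and all-one
    -- completions before and after `Z ω`.
    balance : ∀ ω → J′ ω + count hs (yω ω) ≤ count hs (nω ω) + F ω
    balance ω = subst₂ _≤_ (∑-+ hs _ _) (∑-+ hs _ _) (∑-All-mono (All.map (λ c → beats-telescope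
      (isotone c (context-minimum ctx _))
      (isotone c (context-minimum (context-∷ˡ ctx (Z ω)) _))
      (isotone c (context-maximum ctx _))
      (isotone c (context-minimum ctx _))
      (isotone c (context-maximum ctx _))
      (isotone c (context-minimum ctx _))
      (isotone c (context-maximum ctx _))) confused))

    -- In a win, fewer children accept `nω ω` than `yω ω`; this strictness yields the `1 +`.
    gain : ∀ ω → γ ω ≡ 1 → 1 + J′ ω ≤ F ω
    gain ω γ≡1 = +-cancelˡ-≤ (count hs (nω ω)) _ _ (begin
      count hs (nω ω) + (1 + J′ ω)   ≡⟨ lemma (count hs (nω ω)) (J′ ω) ⟩
      J′ ω + suc (count hs (nω ω))   ≤⟨ +-monoʳ-≤ (J′ ω) (beats⇒count< (yω ω) (nω ω) γ≡1) ⟩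
      J′ ω + count hs (yω ω)         ≤⟨ balance ω ⟩
      count hs (nω ω) + F ω          ∎)
      where
      open ≤-Reasoning
      lemma : ∀ n J → n + (1 + J) ≡ J + suc n
      lemma = solve-∀

    ∑errors≤ : ∀ {h} → Confused X v Ω h → X * ∑ Ω (λ ω → errors ω h) ≤ 2 * (v * Q)
    ∑errors≤ {h} c = begin
      X * ∑ Ω (λ ω → errors ω h)  ≡⟨ cong (X *_) (∑-+ Ω (λ ω → error₀ ω h) (λ ω → error₁ ω h)) ⟩
      X * (∑ Ω (λ ω → error₀ ω h) + ∑ Ω (λ ω → error₁ ω h)) ≡⟨ *-distribˡ-+ X (∑ Ω (λ ω → error₀ ω h)) _ ⟩
      X * ∑ Ω (λ ω → error₀ ω h) + X * ∑ Ω (λ ω → error₁ ω h) ≤⟨ +-mono-≤ (Y-vs-Z c (context-∷ʳ ctx (const-block false))) (Z-vs-N c (context-∷ʳ ctx (const-block true))) ⟩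
      v * Q + v * Q               ≡⟨ cong (v * Q +_) (+-identityʳ (v * Q)) ⟨
      2 * (v * Q)                 ∎
      where open ≤-Reasoning

    ∑F≤ : X * ∑ Ω F ≤ 2 * (v * Q) * live hs κ
    ∑F≤ = begin
      X * ∑ Ω F                                             ≡⟨ cong (X *_) (∑-swap Ω hs _) ⟩
      X * ∑ hs (λ h → ∑ Ω (λ ω → alive h * errors ω h))     ≡⟨ ∑-* hs X _ ⟨
      ∑ hs (λ h → X * ∑ Ω (λ ω → alive h * errors ω h))     ≤⟨ ∑-All-mono (All.map (λ {h} c → step h c) confused) ⟩
      ∑ hs (λ h → 2 * (v * Q) * alive h)                    ≡⟨ ∑-* hs (2 * (v * Q)) alive ⟩
      2 * (v * Q) * live hs κ                               ∎
      where
      open ≤-Reasoning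
      lemma : ∀ X a e → X * (a * e) ≡ X * e * a
      lemma = solve-∀
      step : ∀ h → Confused X v Ω h → X * ∑ Ω (λ ω → alive h * errors ω h) ≤ 2 * (v * Q) * alive h
      step h c = begin
        X * ∑ Ω (λ ω → alive h * errors ω h)   ≡⟨ cong (X *_) (∑-* Ω (alive h) (λ ω → errors ω h)) ⟩
        X * (alive h * ∑ Ω (λ ω → errors ω h)) ≡⟨ lemma X (alive h) _ ⟩
        X * ∑ Ω (λ ω → errors ω h) * alive h   ≤⟨ *-monoˡ-≤ (alive h) (∑errors≤ c) ⟩
        2 * (v * Q) * alive h                  ∎

  -- At most `2 ^ a` children are live at first, so the potential starts at most at `a + 1`. Spread
  -- over `m ≥ X * suc a` positions it contributes at most `v`, and `drift` contributes `4 * v`.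
  half-confuses : ∀ a m → length hs ≤ 2 ^ a → X * suc a ≤ m → 1 ≤ v →
    Confuses X (5 * v) h (half Ω m) proj₁ proj₂
  half-confuses a m |hs|≤ Xa≤m 1≤v {κ} ctx = *-cancelˡ-≤ (2 ^ a) {{m^n≢0 2 a}} (begin
    2 ^ a * (X * ∑ (half Ω m) (win {m} κ))     ≡⟨ lemma₁ (2 ^ a) X _ ⟩
    X * (2 ^ a * ∑ (half Ω m) (win {m} κ))     ≤⟨ bound m a ctx ⟩
    Q ^ m * (X * (2 ^ a * a + live hs κ) + 2 ^ a * (m * (4 * v)))
      ≤⟨ *-monoʳ-≤ (Q ^ m) (+-monoˡ-≤ _ (*-monoʳ-≤ X (+-monoʳ-≤ (2 ^ a * a) (≤-trans live≤ |hs|≤)))) ⟩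
    Q ^ m * (X * (2 ^ a * a + 2 ^ a) + 2 ^ a * (m * (4 * v))) ≡⟨ lemma₂ (Q ^ m) X (2 ^ a) a (m * (4 * v)) ⟩
    2 ^ a * (Q ^ m * (X * suc a + m * (4 * v)))
      ≤⟨ *-monoʳ-≤ (2 ^ a) (*-monoʳ-≤ (Q ^ m) (+-monoˡ-≤ _ (≤-trans Xa≤m (≤-trans (≤-reflexive (sym (*-identityʳ m))) (*-monoʳ-≤ m 1≤v))))) ⟩
    2 ^ a * (Q ^ m * (m * v + m * (4 * v)))    ≡⟨ cong (2 ^ a *_) (lemma₃ (Q ^ m) m v) ⟩
    2 ^ a * (5 * v * (m * Q ^ m))              ≡⟨ cong (λ l → 2 ^ a * (5 * v * l)) (length-half Ω m) ⟨
    2 ^ a * (5 * v * length (half Ω m))        ∎)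
    where
    open ≤-Reasoning
    lemma₁ : ∀ M X s → M * (X * s) ≡ X * (M * s)
    lemma₁ = solve-∀
    lemma₂ : ∀ P X M a w → P * (X * (M * a + M) + M * w) ≡ M * (P * (X * (1 + a) + w))
    lemma₂ = solve-∀
    lemma₃ : ∀ P m v → P * (m * v + m * (4 * v)) ≡ 5 * v * (m * P)
    lemma₃ = solve-∀
    live≤ : live hs κ ≤ length hs
    live≤ = subst (live hs κ ≤_) (sym (length≡∑1 hs)) (∑-mono hs (λ h → beats≤1 (h _) _))

-- Triples that confuse circuits of a given depth

-- Positions past the end read as `false`, in agreement with the padding by `encode`.
bit : ℕ → List Bool → Bool
bit p       []       = false
bit zero    (b ∷ bs) = b
bit (suc p) (b ∷ bs) = bit p bs

bit-isotone : ∀ p → Isotone (bit p)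
bit-isotone p       []       = b≤b
bit-isotone zero    (b ∷ bs) = b
bit-isotone (suc p) (b ∷ bs) = bit-isotone p bs

Elementary : (List Bool → Bool) → Set
Elementary h = (∃[ b ] ∀ x → h x ≡ b) ⊎ (∃[ p ] ∀ x → h x ≡ bit p x)

-- A relaxation of the gates at depth `t` in circuits with at most `2 ^ a` wires: of a threshold
-- gate, only its monotone dependence on the number of accepting children is kept. A child occurs in
-- `hs` once for each wire.
Class : ℕ → ℕ → (List Bool → Bool) → Set
Class a zero    h = Elementary h
Class a (suc t) h = ∃[ hs ] All (Class a t) hs × length hs ≤ 2 ^ a
                    × (∀ x y → count hs x ≤ count hs y → h x ≤ᴮ h y)

⟦⟧-mono : ∀ {p q} → p ≤ᴮ q → ⟦ p ⟧ ≤ ⟦ q ⟧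
⟦⟧-mono f≤t = z≤n
⟦⟧-mono b≤b = ≤-refl

⟦⟧-cancel-≤ : ∀ {p q} → ⟦ p ⟧ ≤ ⟦ q ⟧ → p ≤ᴮ q
⟦⟧-cancel-≤ {false} {q}     _ = Bool.≤-minimum q
⟦⟧-cancel-≤ {true}  {true}  _ = b≤b
⟦⟧-cancel-≤ {true}  {false} ()

Class-isotone : ∀ a t {h} → Class a t h → Isotone h
Class-isotone a zero (inj₁ (b , h≡b)) {x} {y} _ = Bool.≤-reflexive (trans (h≡b x) (sym (h≡b y)))
Class-isotone a zero (inj₂ (p , h≡p)) {x} {y} x≼y = subst₂ _≤ᴮ_ (sym (h≡p x)) (sym (h≡p y)) (bit-isotone p x≼y)
Class-isotone a (suc t) (hs , hs∈ , _ , thr) {x} {y} x≼y =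
  thr x y (∑-All-mono (All.map (λ h∈ → ⟦⟧-mono (Class-isotone a t h∈ x≼y)) hs∈))

-- Children at level `suc t` must all lie at level `t`; gates with a single child carry an input up
-- to the level needed.
Elementary⇒Class : ∀ a t {h} → Elementary h → Class a t h
Elementary⇒Class a zero        e = e
Elementary⇒Class a (suc t) {h} e =
  h ∷ [] , Elementary⇒Class a t e ∷ [] , m^n>0 2 a ,
  λ x y le → ⟦⟧-cancel-≤ (subst₂ _≤_ (+-identityʳ ⟦ h x ⟧) (+-identityʳ ⟦ h y ⟧) le)

bit-++-updateAt : ∀ {l} p (pre : List Bool) (u : Vec Bool l) (i : Fin l) b (rest : List Bool) →
  bit p (pre ++ Vec.toList (u [ i ]≔ b) ++ rest) ≡ bit p (pre ++ Vec.toList u ++ rest) ⊎ p ≡ length pre + toℕ i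
bit-++-updateAt zero    []        (x ∷ u) zero    b rest = inj₂ refl
bit-++-updateAt (suc p) []        (x ∷ u) zero    b rest = inj₁ refl
bit-++-updateAt zero    []        (x ∷ u) (suc i) b rest = inj₁ refl
bit-++-updateAt (suc p) []        (x ∷ u) (suc i) b rest with bit-++-updateAt p [] u i b rest
... | inj₁ eq = inj₁ eq
... | inj₂ eq = inj₂ (cong suc eq)
bit-++-updateAt zero    (_ ∷ pre) u       i       b rest = inj₁ refl
bit-++-updateAt (suc p) (_ ∷ pre) u       i       b rest with bit-++-updateAt p pre u i b rest
... | inj₁ eq = inj₁ eq
... | inj₂ eq = inj₂ (cong suc eq)

∑-tabulate-≡0 : ∀ {n} (g : Fin n → A) (f : A → ℕ) → (∀ i → f (g i) ≡ 0) → ∑ (List.tabulate g) f ≡ 0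
∑-tabulate-≡0 {n = zero}  g f z = refl
∑-tabulate-≡0 {n = suc n} g f z = cong₂ _+_ (z zero) (∑-tabulate-≡0 (g ∘ suc) f (z ∘ suc))

∑-tabulate-≤1 : ∀ {n} (g : Fin n → A) (f : A → ℕ) → (∀ x → f x ≤ 1) →
  (∀ i j → f (g i) ≢ 0 → f (g j) ≢ 0 → i ≡ j) → ∑ (List.tabulate g) f ≤ 1
∑-tabulate-≤1 {n = zero}  g f f≤1 uniq = z≤n
∑-tabulate-≤1 {n = suc n} g f f≤1 uniq with f (g zero) in eq
... | zero  = ∑-tabulate-≤1 (g ∘ suc) f f≤1 λ i j fi fj → suc-injective (uniq (suc i) (suc j) fi fj)
... | suc k = begin
  suc k + ∑ (List.tabulate (g ∘ suc)) f  ≡⟨ cong (suc k +_) (∑-tabulate-≡0 (g ∘ suc) f others) ⟩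
  suc k + 0                              ≡⟨ trans (+-identityʳ _) (sym eq) ⟩
  f (g zero)                             ≤⟨ f≤1 _ ⟩
  1                                      ∎
  where
  open ≤-Reasoning
  others : ∀ i → f (g (suc i)) ≡ 0
  others i with f (g (suc i)) in eq′
  ... | zero  = refl
  ... | suc _ with () ← uniq zero (suc i) (λ e → 1+n≢0 (trans (sym eq) e)) (λ e → 1+n≢0 (trans (sym eq′) e))

beats-≡ : ∀ {p q} → p ≡ q → beats p q ≡ 0
beats-≡ {true}  refl = refl
beats-≡ {false} refl = refl

-- An elementary function reads a single bit, so it sees at most one of many
-- single-bit updates.
Elementary-sees-≤1 : ∀ {h r n} → Elementary h → {κ : Block r 1 → List Bool} → IsContext κ →
  (u : Vec Bool r) (b : Bool) (ι : Fin n → Fin r) → (∀ {i j} → ι i ≡ ι j → i ≡ j) →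
  (g : Fin n → A) (x y : A → Block r 1) →
  (∀ i → (x (g i) ≡ u ∷ [] × y (g i) ≡ (u [ ι i ]≔ b) ∷ []) ⊎ (x (g i) ≡ (u [ ι i ]≔ b) ∷ [] × y (g i) ≡ u ∷ [])) →
  ∑ (List.tabulate g) (λ ω → beats (h (κ (x ω))) (h (κ (y ω)))) ≤ 1
Elementary-sees-≤1 (inj₁ (b , h≡b)) {κ} ctx u _ ι ι-inj g x y xy =
  ≤-trans (≤-reflexive (∑-tabulate-≡0 g _ λ i → beats-≡ (trans (h≡b _) (sym (h≡b _))))) z≤n
Elementary-sees-≤1 {h = h} {n = n} (inj₂ (p , h≡p)) {κ} (context pre w post shape) u b ι ι-inj g x y xy =
  ∑-tabulate-≤1 g _ (λ ω → beats≤1 (h (κ (x ω))) _)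
    λ i j fi fj → ι-inj (toℕ-injective (+-cancelˡ-≡ (length pre) _ _ (trans (sym (position i fi)) (position j fj))))
  where
  read : ∀ v → h (κ (v ∷ [])) ≡ bit p (pre ++ Vec.toList v ++ ((w ++ []) ++ post))
  read v = trans (h≡p _) (cong (bit p) (trans (shape (v ∷ [])) (cong (pre ++_) (++-assoc (Vec.toList v) (w ++ []) post))))
  position : ∀ i → beats (h (κ (x (g i)))) (h (κ (y (g i)))) ≢ 0 → p ≡ length pre + toℕ (ι i)
  position i f≢0 with bit-++-updateAt p pre u (ι i) b ((w ++ []) ++ post)
  ... | inj₂ eq = eq
  ... | inj₁ eq with xy i
  ...   | inj₁ (xi , yi) rewrite xi | yi = contradiction (beats-≡ (trans (read u) (trans (sym eq) (sym (read _))))) f≢0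
  ...   | inj₂ (xi , yi) rewrite xi | yi = contradiction (beats-≡ (trans (read _) (trans eq (sym (read u))))) f≢0

length-concatMap-map : (f : A → A → A′) (xs ys : List A) →
  length (concatMap (λ x → List.map (f x) ys) xs) ≡ length xs * length ys
length-concatMap-map f xs ys = begin
  length zs                                        ≡⟨ length≡∑1 zs ⟩
  ∑ zs (λ _ → 1)                                   ≡⟨ ∑-concatMap _ xs _ ⟩
  ∑ xs (λ x → ∑ (List.map (f x) ys) (λ _ → 1))     ≡⟨ ∑-cong xs (λ x → trans (∑-map (f x) ys _) (sym (length≡∑1 ys))) ⟩
  ∑ xs (λ _ → length ys)                           ≡⟨ ∑-const xs _ ⟩
  length xs * length ys                            ∎
  where
  open ≡-Reasoning
  zs = concatMap (λ x → List.map (f x) ys) xs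

-- Recursive samples

ramp : ∀ c → ℕ → Vec Bool c
ramp zero    t       = []
ramp (suc c) zero    = false ∷ ramp c zero
ramp (suc c) (suc t) = true ∷ ramp c t

module Samples (c m : ℕ) where

  rows cols : ℕ → ℕ
  rows zero    = c + c
  rows (suc t) = rows t + c
  cols zero    = 1
  cols (suc t) = m * cols t + suc (m * cols t)

  all : ∀ {n} → Bool → Vec Bool n
  all b = Vec.replicate _ b

  -- Its `c` ones keep state 1, since `1 * suc c ∸ c = 1`. Switching on one of the `c` zeros leads
  -- to state 0, switching off one of the `c` ones to state 2, and a function reading a single bit
  -- notices at most one of the `c` switches.
  neutral : Vec Bool (c + c)
  neutral = all {c} false Vec.++ all {c} true

  base : Fin c → Triple (c + c) 1
  base i = triple ((neutral [ i ↑ˡ c ]≔ true) ∷ []) (neutral ∷ []) ((neutral [ c ↑ʳ i ]≔ false) ∷ [])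

  -- A column that takes state t + 2 to state 2.
  turn : ∀ t → Vec Bool (rows (suc t))
  turn t = all true Vec.++ ramp c t

  -- The c further rows of ones in the second half raise every state by 1 there,
  -- so that Z, unlike N, returns to state 1.
  combine : ∀ t (p q : Block (rows t) (m * cols t) × Block (rows t) (m * cols t)) → Triple (rows (suc t)) (cols (suc t))
  combine t (y₁ , n₁) (y₂ , n₂) = triple
    (extend (all false) y₁ Vec.++ const-block false)
    (extend (all false) n₁ Vec.++ (turn t ∷ extend (all true) y₂))
    (extend (all false) n₁ Vec.++ (turn t ∷ extend (all true) n₂))

  -- The two halves are chosen independently, so that either can be fixed while averaging over the
  -- other.
  samples : ∀ t → List (Triple (rows t) (cols t))
  samples zero    = List.tabulate base
  samples (suc t) = concatMap (λ p → List.map (combine t p) halves) halves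
    where halves = half (samples t) m

  ∑-samples-suc : ∀ t f → ∑ (samples (suc t)) f ≡
    ∑ (half (samples t) m) (λ p → ∑ (half (samples t) m) (λ q → f (combine t p q)))
  ∑-samples-suc t f = trans (∑-concatMap _ halves f) (∑-cong halves λ p → ∑-map (combine t p) halves f)
    where halves = half (samples t) m

  length-samples-suc : ∀ t → length (samples (suc t)) ≡ length (half (samples t) m) * length (half (samples t) m)
  length-samples-suc t = length-concatMap-map (combine t) (half (samples t) m) (half (samples t) m)

  samples-nonempty : 1 ≤ c → 1 ≤ m → ∀ t → 1 ≤ length (samples t)
  samples-nonempty 1≤c 1≤m zero    = subst (1 ≤_) (sym (length-tabulate base)) 1≤c
  samples-nonempty 1≤c 1≤m (suc t) = subst (1 ≤_) (sym (length-samples-suc t)) (*-mono-≤ 1≤half 1≤half)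
    where
    Q = length (samples t)
    1≤half : 1 ≤ length (half (samples t) m)
    1≤half = subst (1 ≤_) (sym (length-half (samples t) m))
      (*-mono-≤ 1≤m (m^n>0 Q {{>-nonZero (samples-nonempty 1≤c 1≤m t)}} m))

  module _ {X a : ℕ} (X≤c : X ≤ c) (Xa≤m : X * suc a ≤ m) where

    -- At depth 0 at most one of the `c` samples is told apart, and `X ≤ c`; each level multiplies
    -- the rate by 5. For `Y` against `Z` the average is over the first half with the second fixed,
    -- for `Z` against `N` the other way round.
    confused : ∀ t {h} → Class a t h → Confused X (5 ^ t) (samples t) h
    confused zero {h} e = record
      { isotone = Class-isotone a 0 e
      ; Y-vs-Z  = λ {κ} ctx → scale (Elementary-sees-≤1 e ctx neutral true (_↑ˡ c) (↑ˡ-injective c _ _) base Y Z (λ _ → inj₂ (refl , refl)))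
      ; Z-vs-N  = λ {κ} ctx → scale (Elementary-sees-≤1 e ctx neutral false (c ↑ʳ_) (↑ʳ-injective c _ _) base Z N (λ _ → inj₁ (refl , refl)))
      }
      where
      scale : ∀ {n} → n ≤ 1 → X * n ≤ 1 * length (samples 0)
      scale {n} n≤1 = begin
        X * n                  ≤⟨ *-mono-≤ X≤c n≤1 ⟩
        c * 1                  ≡⟨ trans (*-identityʳ c) (sym (+-identityʳ c)) ⟩
        1 * c                  ≡⟨ cong (1 *_) (length-tabulate base) ⟨
        1 * length (samples 0) ∎
        where open ≤-Reasoning
    confused (suc t) {h} cl@(hs , hs∈ , |hs|≤ , thr) = record
      { isotone = iso
      ; Y-vs-Z  = λ {κ} ctx → begin
          X * ∑ (samples (suc t)) (λ ω → beats (h (κ (Y ω))) (h (κ (Z ω))))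
            ≡⟨ cong (X *_) (trans (∑-samples-suc t _) (∑-swap halves halves _)) ⟩
          X * ∑ halves (λ q → ∑ halves (λ p → beats (h (κ (Y (combine t p q)))) (h (κ (Z (combine t p q))))))
            -- By isotonicity the zeros that end `Y` may be replaced by the second half of `Z`; then
            -- the two differ in the first half only.
            ≤⟨ average (λ q → ≤-trans
                 (*-monoʳ-≤ X (∑-mono halves λ p → beats-mono (iso (context-minimum (context-∷ˡ ctx (extend (all false) (proj₁ p))) _)) Bool.≤-refl))
                 (step (context-extend (context-∷ʳ ctx (turn t ∷ extend (all true) (proj₁ q))) (all false)))) ⟩
          5 ^ suc t * length (samples (suc t)) ∎
      ; Z-vs-N  = λ {κ} ctx → begin
          X * ∑ (samples (suc t)) (λ ω → beats (h (κ (Z ω))) (h (κ (N ω))))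
            ≡⟨ cong (X *_) (∑-samples-suc t _) ⟩
          X * ∑ halves (λ p → ∑ halves (λ q → beats (h (κ (Z (combine t p q)))) (h (κ (N (combine t p q))))))
            ≤⟨ average (λ p → step (context-extend (context-∷ˡ {L = 1} (context-∷ˡ ctx (extend (all false) (proj₂ p))) (turn t ∷ [])) (all true))) ⟩
          5 ^ suc t * length (samples (suc t)) ∎
      }
      where
      open ≤-Reasoning
      halves = half (samples t) m
      iso = Class-isotone a (suc t) cl
      step : Confuses X (5 * 5 ^ t) h halves proj₁ proj₂
      step = half-confuses (All.map (confused t) hs∈) thr a m |hs|≤ Xa≤m (m^n>0 5 t)
      average : ∀ {f : _ → ℕ} → (∀ p → X * f p ≤ 5 ^ suc t * length halves) →
        X * ∑ halves f ≤ 5 ^ suc t * length (samples (suc t))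
      average {f} le = begin
        X * ∑ halves f                               ≡⟨ ∑-* halves X f ⟨
        ∑ halves (λ p → X * f p)                     ≤⟨ ∑-mono halves le ⟩
        ∑ halves (λ _ → 5 ^ suc t * length halves)   ≡⟨ ∑-const halves _ ⟩
        length halves * (5 ^ suc t * length halves)  ≡⟨ lemma (length halves) (5 ^ suc t) ⟩
        5 ^ suc t * (length halves * length halves)  ≡⟨ cong (5 ^ suc t *_) (length-samples-suc t) ⟨
        5 ^ suc t * length (samples (suc t))         ∎
        where
        lemma : ∀ l v → l * (v * l) ≡ v * (l * l)
        lemma = solve-∀

-- Counting ones in columns

ones : List Bool → ℕ
ones bs = ∑ bs ⟦_⟧

ones-zeros : ∀ n → ones (List.replicate n false) ≡ 0
ones-zeros n = trans (∑-replicate n false ⟦_⟧) (*-zeroʳ n)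

weight : ∀ {r} → Vec Bool r → ℕ
weight v = ones (Vec.toList v)

weight-++ : ∀ {r s} (u : Vec Bool r) (v : Vec Bool s) → weight (u Vec.++ v) ≡ weight u + weight v
weight-++ u v = trans (cong ones (toList-++ u v)) (∑-++ (Vec.toList u) (Vec.toList v) ⟦_⟧)

weight-replicate : ∀ r b → weight (Vec.replicate r b) ≡ r * ⟦ b ⟧
weight-replicate r b = trans (cong ones (toList-replicate r b)) (∑-replicate r b ⟦_⟧)

weight-ones : ∀ r → weight (Vec.replicate r true) ≡ r
weight-ones r = trans (weight-replicate r true) (*-identityʳ r)

weight-zeros : ∀ r → weight (Vec.replicate r false) ≡ 0
weight-zeros r = trans (weight-replicate r false) (*-zeroʳ r)

weight-ramp : ∀ c t → t ≤ c → weight (ramp c t) ≡ t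
weight-ramp zero    zero    _         = refl
weight-ramp (suc c) zero    _         = weight-ramp c zero z≤n
weight-ramp (suc c) (suc t) (s≤s t≤c) = cong suc (weight-ramp c t t≤c)

weight-switch-on : ∀ {r s} (v : Vec Bool s) (i : Fin r) →
  weight ((Vec.replicate r false Vec.++ v) [ i ↑ˡ s ]≔ true) ≡ suc (weight (Vec.replicate r false Vec.++ v))
weight-switch-on v zero    = refl
weight-switch-on v (suc i) = weight-switch-on v i

weight-switch-off : ∀ r {s} (i : Fin s) →
  suc (weight ((Vec.replicate r false Vec.++ Vec.replicate s true) [ r ↑ʳ i ]≔ false))
    ≡ weight (Vec.replicate r false Vec.++ Vec.replicate s true)
weight-switch-off zero    zero    = refl
weight-switch-off zero    (suc i) = cong suc (weight-switch-off zero i)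
weight-switch-off (suc r) i       = weight-switch-off r i

take-length-++ : ∀ {n} (xs : List A) {ys} → n ≡ length xs → take n (xs ++ ys) ≡ xs
take-length-++ []       refl = refl
take-length-++ (x ∷ xs) refl = cong (x ∷_) (take-length-++ xs refl)

drop-length-++ : ∀ {n} (xs : List A) {ys} → n ≡ length xs → drop n (xs ++ ys) ≡ ys
drop-length-++ []       refl = refl
drop-length-++ (x ∷ xs) refl = drop-length-++ xs refl

≤ᵇ-true : ∀ {m n} → m ≤ n → (m ≤ᵇ n) ≡ true
≤ᵇ-true m≤n = T-≡ (≤⇒≤ᵇ m≤n)
  where
  T-≡ : ∀ {b} → T b → b ≡ true
  T-≡ {true} _ = refl

≤ᵇ-false : ∀ {m n} → n < m → (m ≤ᵇ n) ≡ false
≤ᵇ-false {m} {n} n<m with m ≤ᵇ n in eq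
... | false = refl
... | true  = contradiction (≤ᵇ⇒≤ m n (subst T (sym eq) _)) (<⇒≱ n<m)

All-ones : ∀ {zs} → All (_≡ false) zs → ones zs ≡ 0
All-ones []          = refl
All-ones (refl ∷ zs) = All-ones zs

-- The automaton

-- With B = c + 1, and for a ≥ 1, this decides a B ^ n ≤ Σ fᵢ B ^ (n - i), where
-- fᵢ is the number of ones in the i-th of n columns of k bits.

accept : (c k n a : ℕ) → List Bool → Bool
accept c k zero    a xs = false
accept c k (suc n) a xs =
  (a * suc c ≤ᵇ ones (take k xs)) ∨ accept c k n (a * suc c ∸ ones (take k xs)) (drop k xs)

take-mono : ∀ k {xs ys} → xs ≼ ys → take k xs ≼ take k ys
take-mono zero    _        = []
take-mono (suc k) []       = []
take-mono (suc k) (b ∷ bs) = b ∷ take-mono k bs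

drop-mono : ∀ k {xs ys} → xs ≼ ys → drop k xs ≼ drop k ys
drop-mono zero    bs       = bs
drop-mono (suc k) []       = []
drop-mono (suc k) (b ∷ bs) = drop-mono k bs

ones-mono : ∀ {xs ys} → xs ≼ ys → ones xs ≤ ones ys
ones-mono []       = z≤n
ones-mono (b ∷ bs) = +-mono-≤ (⟦⟧-mono b) (ones-mono bs)

T⇒≤ : ∀ {p q} → (T p → T q) → p ≤ᴮ q
T⇒≤ {false} {q}     _ = Bool.≤-minimum q
T⇒≤ {true}  {true}  _ = b≤b
T⇒≤ {true}  {false} f with () ← f _

∨-mono : ∀ {p q p′ q′} → p ≤ᴮ p′ → q ≤ᴮ q′ → p ∨ q ≤ᴮ p′ ∨ q′
∨-mono {p} {q} f≤t _ = Bool.≤-maximum q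
∨-mono {true}  b≤b _ = b≤b
∨-mono {false} b≤b q = q

accept-mono : ∀ c k n {a a′ xs ys} → a′ ≤ a → xs ≼ ys → accept c k n a xs ≤ᴮ accept c k n a′ ys
accept-mono c k zero    _    _     = b≤b
accept-mono c k (suc n) a′≤a xs≼ys = ∨-mono
  (T⇒≤ λ le → ≤⇒≤ᵇ (≤-trans a′B≤aB (≤-trans (≤ᵇ⇒≤ _ _ le) f≤)))
  (accept-mono c k n (∸-mono a′B≤aB f≤) (drop-mono k xs≼ys))
  where
  a′B≤aB = *-monoˡ-≤ (suc c) a′≤a
  f≤     = ones-mono (take-mono k xs≼ys)

-- Runs of the automaton through blocks

module Runs (c : ℕ) where

  -- u is the number of ones in the further rows below each column.
  data Run {r} (u : ℕ) : ∀ {L} → ℕ → Block r L → ℕ → Set where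
    []  : ∀ {a} → Run u a [] a
    _∷_ : ∀ {L a b a′ col} {x : Block r L} → a * suc c ≡ weight col + u + b → Run u b x a′ → Run u a (col ∷ x) a′

  run-++ : ∀ {r u L L′ a b a′} {x : Block r L} {y : Block r L′} → Run u a x b → Run u b y a′ → Run u a (x Vec.++ y) a′
  run-++ []       s = s
  run-++ (e ∷ r) s = e ∷ run-++ r s

  run-extend : ∀ {r s u L a a′} {x : Block r L} (w : Vec Bool s) → Run (weight w + u) a x a′ → Run u a (extend w x) a′
  run-extend w [] = []
  run-extend {u = u} w (_∷_ {b = b} {col = col} e r) =
    trans e (cong (_+ b) (trans (sym (+-assoc (weight col) (weight w) u)) (cong (_+ u) (sym (weight-++ col w)))))
    ∷ run-extend w r

  run-const : ∀ {r} u L a b → a * suc c ≡ r * ⟦ b ⟧ + u + a → Run {r} u {L} a (const-block b) a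
  run-const u zero    a b e = []
  run-const {r} u (suc L) a b e = trans e (cong (λ f → f + u + a) (sym (weight-replicate r b))) ∷ run-const u L a b e

  -- State 0 is followed only by state 0, because `0 = weight col + u + b` forces `b = 0`.
  run-positive : ∀ {r u L a a′} {x : Block r L} → Run u a x a′ → 1 ≤ a′ → 1 ≤ a
  run-positive [] 1≤a′ = 1≤a′
  run-positive {u = u} {a = suc a} (_∷_ {col = col} e r) 1≤a′ = s≤s z≤n
  run-positive {u = u} {a = zero} (_∷_ {b = b} {col = col} e r) 1≤a′ with run-positive r 1≤a′
  ... | 1≤b = contradiction (≤-trans 1≤b (≤-trans (m≤n+m b (weight col + u)) (≤-reflexive (sym e)))) λ ()

  module _ {r : ℕ} (w : List Bool) {k : ℕ} (k≡ : r + length w ≡ k) {post : List Bool} (post≡0 : All (_≡ false) post) where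

    length-column : ∀ (col : Vec Bool r) → k ≡ length (Vec.toList col ++ w)
    length-column col = sym (trans (length-++ (Vec.toList col)) (trans (cong (_+ length w) (length-toList col)) k≡))

    flat-∷ : ∀ {L} (col : Vec Bool r) (x : Block r L) →
      flat w (col ∷ x) ++ post ≡ (Vec.toList col ++ w) ++ flat w x ++ post
    flat-∷ col x = begin
      (Vec.toList col ++ w ++ flat w x) ++ post ≡⟨ cong (_++ post) (++-assoc (Vec.toList col) w _) ⟨
      ((Vec.toList col ++ w) ++ flat w x) ++ post ≡⟨ ++-assoc (Vec.toList col ++ w) _ post ⟩
      (Vec.toList col ++ w) ++ flat w x ++ post ∎
      where open ≡-Reasoning

    column-ones : ∀ {L} (col : Vec Bool r) (x : Block r L) → ones (take k (flat w (col ∷ x) ++ post)) ≡ weight col + ones w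
    column-ones col x = begin
      ones (take k (flat w (col ∷ x) ++ post)) ≡⟨ cong (ones ∘ take k) (flat-∷ col x) ⟩
      ones (take k ((Vec.toList col ++ w) ++ flat w x ++ post))
        ≡⟨ cong ones (take-length-++ (Vec.toList col ++ w) (length-column col)) ⟩
      ones (Vec.toList col ++ w)               ≡⟨ ∑-++ (Vec.toList col) w ⟦_⟧ ⟩
      weight col + ones w                      ∎
      where open ≡-Reasoning

    drop-column : ∀ {L} (col : Vec Bool r) (x : Block r L) → drop k (flat w (col ∷ x) ++ post) ≡ flat w x ++ post
    drop-column col x = trans (cong (drop k) (flat-∷ col x)) (drop-length-++ (Vec.toList col ++ w) (length-column col))

    accept-∷ : ∀ {L} n a b (col : Vec Bool r) (x : Block r L) → a * suc c ≡ weight col + ones w + b →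
      accept c k (suc n) a (flat w (col ∷ x) ++ post)
        ≡ (weight col + ones w + b ≤ᵇ weight col + ones w) ∨ accept c k n b (flat w x ++ post)
    accept-∷ n a b col x e rewrite column-ones col x | drop-column col x | e | m+n∸m≡n (weight col + ones w) b = refl

    -- Acceptance occurs at the first column after which the state is 0; there is one, as the run
    -- starts at a positive state and ends at 0.
    run-accept : ∀ {L n a} {x : Block r L} → Run (ones w) a x 0 → 1 ≤ a → L ≤ n →
      accept c k n a (flat w x ++ post) ≡ true
    run-accept {a = a} {x = col ∷ x} (_∷_ {b = zero} e run) 1≤a (s≤s {n = n} L≤n) = trans (accept-∷ n a 0 col x e)
      (cong (_∨ _) (≤ᵇ-true (≤-reflexive (+-identityʳ (weight col + ones w)))))
    run-accept {a = a} {x = col ∷ x} (_∷_ {b = suc b} e run) 1≤a (s≤s {n = n} L≤n) = trans (accept-∷ n a (suc b) col x e)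
      (trans (cong (p ∨_) (run-accept run (s≤s z≤n) L≤n)) (Bool.∨-zeroʳ p))
      where p = weight col + ones w + suc b ≤ᵇ weight col + ones w

    zeros-reject : ∀ n a {zs} → 1 ≤ a → All (_≡ false) zs → accept c k n a zs ≡ false
    zeros-reject zero    a       1≤a zs≡0 = refl
    zeros-reject (suc n) (suc a) 1≤a zs≡0 rewrite All-ones (All.take⁺ k zs≡0) =
      zeros-reject n (suc a * suc c) (s≤s z≤n) (All.drop⁺ k zs≡0)

    -- A positive final state forces all earlier states to be positive, so no column meets its
    -- deficit; the zeros that follow only multiply the state by `suc c`.
    run-reject : ∀ {L} n {a a′} {x : Block r L} → Run (ones w) a x a′ → 1 ≤ a′ →
      accept c k n a (flat w x ++ post) ≡ false
    run-reject n [] 1≤a′ = zeros-reject n _ 1≤a′ post≡0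
    run-reject zero (e ∷ run) 1≤a′ = refl
    run-reject (suc n) {a} {x = col ∷ x} (_∷_ {b = b} e run) 1≤a′ = trans (accept-∷ n a b col x e)
      (cong₂ _∨_ (≤ᵇ-false (m<m+n (weight col + ones w) (run-positive run 1≤a′))) (run-reject n run 1≤a′))

  module _ (m : ℕ) where
    open Samples c m

    rows≡ : ∀ t → rows t ≡ (2 + t) * c
    rows≡ zero    = cong (c +_) (sym (+-identityʳ c))
    rows≡ (suc t) = trans (+-comm (rows t) c) (cong (c +_) (rows≡ t))

    -- e * c further ones in every column raise all states by e.
    PairRuns : ∀ t {L} → Block (rows t) L × Block (rows t) L → Set
    PairRuns t (y , n) = ∀ e → Run (e * c) (suc e) y e × Run (e * c) (suc e) n (2 + t + e)

    TripleRuns : ∀ t {L} → Triple (rows t) L → Set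
    TripleRuns t ω = ∀ e → Run (e * c) (suc e) (Y ω) e × Run (e * c) (suc e) (Z ω) (suc e)
                         × Run (e * c) (suc e) (N ω) (2 + t + e)

    -- The constant blocks that pad a half leave its final state in place: `e * suc c = e * c + e`
    -- for zeros, and the number of rows is chosen so that columns of ones fix `2 + t + e`.
    run-zeros : ∀ {r L} e → Run {r} (e * c) {L} e (const-block false) e
    run-zeros {r} {L} e = run-const (e * c) L e false
      (trans (trans (*-suc e c) (+-comm e (e * c))) (cong (λ z → z + e * c + e) (sym (*-zeroʳ r))))

    run-ones : ∀ t {L} e → Run {rows t} (e * c) {L} (2 + t + e) (const-block true) (2 + t + e)
    run-ones t {L} e = run-const (e * c) L (2 + t + e) true
      (trans (lemma t e c) (cong (λ z → z + e * c + (2 + t + e)) (sym (trans (*-identityʳ (rows t)) (rows≡ t)))))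
      where
      lemma : ∀ t e c → (2 + t + e) * (1 + c) ≡ (2 + t) * c + e * c + (2 + t + e)
      lemma = solve-∀

    half-runs : ∀ t {L} {Ω : List (Triple (rows t) L)} → All (TripleRuns t) Ω → ∀ j → All (PairRuns t) (half Ω j)
    half-runs t {Ω = Ω} runs zero    = []
    half-runs t {Ω = Ω} runs (suc j) = All.++⁺
      (All.concat⁺ (All.map⁺ (All.map (λ r → All.replicate⁺ _ λ e →
        run-++ (proj₁ (r e)) (run-zeros e) , run-++ (proj₂ (proj₂ (r e))) (run-ones t e)) runs)))
      (All.concat⁺ (All.map⁺ (All.map (λ r → All.map⁺ (All.map (λ s e →
        run-++ (proj₁ (proj₂ (r e))) (proj₁ (s e)) , run-++ (proj₁ (proj₂ (r e))) (proj₂ (s e))) (half-runs t runs j))) runs)))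

    -- From `1 + e`, `n₁` leads to `2 + t + e` and the turn to `2 + e`. The second half runs with
    -- `e` raised by one, so `y₂` leads back to `1 + e` and `n₂` on to `3 + t + e`. The ramp has
    -- room for `t` ones because `t ≤ c`.
    combine-runs : ∀ t → t ≤ c → ∀ p q → PairRuns t p → PairRuns t q → TripleRuns (suc t) (combine t p q)
    combine-runs t t≤c (y₁ , n₁) (y₂ , n₂) rp rq e =
      run-++ (run-extend (all false) (subst (λ u → Run u (suc e) y₁ e) zeros-u (proj₁ (rp e)))) (run-zeros e) ,
      run-++ first (turn-step ∷ run-extend (all true) (subst (λ u → Run u (2 + e) y₂ (suc e)) ones-u (proj₁ (rq (suc e))))) ,
      run-++ first (turn-step ∷ run-extend (all true)
        (subst₂ (λ u b → Run u (2 + e) n₂ b) ones-u (cong (2 +_) (+-suc t e)) (proj₂ (rq (suc e)))))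
      where
      zeros-u : e * c ≡ weight (all {c} false) + e * c
      zeros-u = cong (_+ e * c) (sym (weight-zeros c))
      ones-u : suc e * c ≡ weight (all {c} true) + e * c
      ones-u = cong (_+ e * c) (sym (weight-ones c))
      first : Run (e * c) (suc e) (extend (all false) n₁) (2 + t + e)
      first = run-extend (all false) (subst (λ u → Run u (suc e) n₁ (2 + t + e)) zeros-u (proj₂ (rp e)))
      turn-step : (2 + t + e) * suc c ≡ weight (turn t) + e * c + (2 + e)
      turn-step = trans (lemma t e c) (cong (λ z → z + e * c + (2 + e)) (sym (begin
        weight (turn t)                               ≡⟨ weight-++ (all {rows t} true) (ramp c t) ⟩
        weight (all {rows t} true) + weight (ramp c t) ≡⟨ cong₂ _+_ (trans (weight-ones (rows t)) (rows≡ t)) (weight-ramp c t t≤c) ⟩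
        (2 + t) * c + t                               ∎)))
        where
        open ≡-Reasoning
        lemma : ∀ t e c → (2 + t + e) * (1 + c) ≡ (2 + t) * c + t + e * c + (2 + e)
        lemma = solve-∀

    base-runs : ∀ i → TripleRuns 0 (base i)
    base-runs i e =
      trans (lemma-Y c e) (cong (λ z → z + e * c + e) (sym (trans (weight-switch-on (all {c} true) i) (cong suc weight-neutral)))) ∷ [] ,
      trans (lemma-Z c e) (cong (λ z → z + e * c + suc e) (sym weight-neutral)) ∷ [] ,
      trans (trans (lemma-Z c e) (cong (λ z → z + e * c + suc e) (sym (trans (weight-switch-off c i) weight-neutral))))
        (lemma-N (weight (neutral [ c ↑ʳ i ]≔ false)) (e * c) e) ∷ []
      where
      weight-neutral : weight neutral ≡ c
      weight-neutral = trans (weight-++ (all {c} false) (all {c} true)) (cong₂ _+_ (weight-zeros c) (weight-ones c))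
      lemma-Y : ∀ c e → (1 + e) * (1 + c) ≡ (1 + c) + e * c + e
      lemma-Y = solve-∀
      lemma-Z : ∀ c e → (1 + e) * (1 + c) ≡ c + e * c + (1 + e)
      lemma-Z = solve-∀
      lemma-N : ∀ f u e → 1 + f + u + (1 + e) ≡ f + u + (2 + e)
      lemma-N = solve-∀

    samples-runs : ∀ t → t ≤ c → All (TripleRuns t) (samples t)
    samples-runs zero    _   = All.tabulate⁺ base-runs
    samples-runs (suc t) t<c = All.concat⁺ (All.map⁺ (All.map (λ {p} rp → All.map⁺ (All.map (λ {q} rq →
        combine-runs t (<⇒≤ t<c) p q rp rq) halves)) halves))
      where halves = half-runs t (samples-runs t (<⇒≤ t<c)) m

-- The lower bound

encode : ∀ M → List Bool → Vec Bool M
encode zero    xs       = []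
encode (suc M) []       = false ∷ encode M []
encode (suc M) (x ∷ xs) = x ∷ encode M xs

lookup-encode : ∀ M xs (i : Fin M) → Vec.lookup (encode M xs) i ≡ bit (toℕ i) xs
lookup-encode (suc M) []       zero    = refl
lookup-encode (suc M) []       (suc i) = lookup-encode M [] i
lookup-encode (suc M) (x ∷ xs) zero    = refl
lookup-encode (suc M) (x ∷ xs) (suc i) = lookup-encode M xs i

toList-encode : ∀ M xs → length xs ≤ M → ∃[ zs ] Vec.toList (encode M xs) ≡ xs ++ zs × All (_≡ false) zs
toList-encode zero    []       _ = [] , refl , []
toList-encode (suc M) []       _ with zs , eq , zs≡0 ← toList-encode M [] z≤n =
  false ∷ zs , cong (false ∷_) eq , refl ∷ zs≡0
toList-encode (suc M) (x ∷ xs) (s≤s le) with zs , eq , zs≡0 ← toList-encode M xs le =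
  zs , cong (x ∷_) eq , zs≡0

-- Threshold circuits belong to the classes

module _ {M : ℕ} where

  private
    value : ∀ {k} → Gates Threshold M k → Node Threshold M k → List Bool → Bool
    value gs node xs = atNode {Threshold} (readMonotoneInput (encode M xs)) THR (atGates (readMonotoneInput (encode M xs)) THR gs) node

    height : ∀ {k} → Gates Threshold M k → Node Threshold M k → ℕ
    height gs = atNode {Threshold} {M} (λ _ → 0) (λ _ ds → suc (foldr₁ _⊔_ ds)) (atGates (λ _ → 0) (λ _ ds → suc (foldr₁ _⊔_ ds)) gs)

  foldr₁-⊔-≤ : ∀ {A : Set} {t} (f : A → ℕ) x xs → foldr₁ _⊔_ (List⁺.map f (x ∷ xs)) ≤ t → All (λ x → f x ≤ t) (x ∷ xs)
  foldr₁-⊔-≤ f x []       le = le ∷ []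
  foldr₁-⊔-≤ f x (y ∷ ys) le = ≤-trans (m≤m⊔n _ _) le ∷ foldr₁-⊔-≤ f y ys (≤-trans (m≤n⊔m _ _) le)

  length-filterᵇ-id : ∀ bs → length (filterᵇ id bs) ≡ ∑ bs ⟦_⟧
  length-filterᵇ-id []           = refl
  length-filterᵇ-id (true ∷ bs)  = cong suc (length-filterᵇ-id bs)
  length-filterᵇ-id (false ∷ bs) = length-filterᵇ-id bs

  THR-mono : ∀ t bs bs′ → ∑ (toList bs) ⟦_⟧ ≤ ∑ (toList bs′) ⟦_⟧ → THR t bs ≤ᴮ THR t bs′
  THR-mono t bs bs′ le with t ℤ.≤? ℤ.+ length (filterᵇ id (toList bs)) | t ℤ.≤? ℤ.+ length (filterᵇ id (toList bs′))
  ... | no _  | q     = Bool.≤-minimum (does q)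
  ... | yes _ | yes _ = b≤b
  ... | yes p | no ¬q = contradiction (ℤ.≤-trans p (ℤ.+≤+ (subst₂ _≤_ (sym (length-filterᵇ-id (toList bs))) (sym (length-filterᵇ-id (toList bs′))) le))) ¬q

  mutual
    -- The in-degree of a gate is at most `#wires`, hence at most `2 ^ a`, and the tails of its
    -- wires have smaller height, which gives an induction on `t`.
    Class-node : ∀ {k a} t (gs : Gates Threshold M k) node → #wires gs ≤ 2 ^ a → height gs node ≤ t → Class a t (value gs node)
    Class-node {a = a} t gs (input (const b)) _ _ = Elementary⇒Class a t (inj₁ (b , λ _ → refl))
    Class-node {a = a} t gs (input (var i))   _ _ = Elementary⇒Class a t (inj₂ (toℕ i , λ xs → lookup-encode M xs i))
    Class-node t gs (gate i) small low = Class-gate t gs i small low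

    Class-gate : ∀ {k a} t (gs : Gates Threshold M k) i → #wires gs ≤ 2 ^ a → height gs (gate i) ≤ t → Class a t (value gs (gate i))
    Class-gate t       (gs ▷ θ ∙ ws)       (suc i) small low = Class-gate t gs i (≤-trans (m≤n+m _ (List⁺.length ws)) small) low
    Class-gate {a = a} (suc t) (gs ▷ θ ∙ (w ∷ ws)) zero small (s≤s low) =
      List.map (value gs) (w ∷ ws) ,
      All.map⁺ (All.map (λ {w} → Class-node t gs w (≤-trans (m≤n+m _ (suc (length ws))) small)) (foldr₁-⊔-≤ (height gs) w ws low)) ,
      ≤-trans (≤-reflexive (length-map (value gs) (w ∷ ws))) (≤-trans (m≤m+n _ _) small) ,
      λ x y le → THR-mono θ (inputs x) (inputs y) (subst₂ _≤_ (read x) (read y) le)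
      where
      inputs : List Bool → List⁺ Bool
      inputs x = List⁺.map (λ w → value gs w x) (w ∷ ws)
      read : ∀ x → count (List.map (value gs) (w ∷ ws)) x ≡ ∑ (toList (inputs x)) ⟦_⟧
      read x = trans (∑-map (value gs) (w ∷ ws) _) (sym (∑-map (λ w → value gs w x) (w ∷ ws) ⟦_⟧))

  Class-circuit : ∀ {a t} (C : Circuit Threshold M) → size C ≤ 2 ^ a → depth C ≤ t → Class a t (λ xs → eval C (encode M xs))
  Class-circuit {t = t} (circuit gs out) = Class-node t gs out

length-flat : ∀ {r L} w (x : Block r L) → length (flat w x) ≡ L * (r + length w)
length-flat w []        = refl
length-flat {r} {suc L} w (col ∷ x) = begin
  length (Vec.toList col ++ w ++ flat w x)       ≡⟨ length-++ (Vec.toList col) ⟩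
  length (Vec.toList col) + length (w ++ flat w x) ≡⟨ cong₂ _+_ (length-toList col) (length-++ w) ⟩
  r + (length w + length (flat w x))             ≡⟨ +-assoc r (length w) _ ⟨
  r + length w + length (flat w x)               ≡⟨ cong (r + length w +_) (length-flat w x) ⟩
  suc L * (r + length w)                         ∎
  where open ≡-Reasoning

-- This is (c + 1) ^ 2 - 1: with more rows, states above c + 1 could decrease.
#rows : ℕ → ℕ
#rows c = (2 + c) * c

-- Choice of the base, and the function itself

search : ℕ → ℕ → ℕ
search n zero    = 0
search n (suc b) with 2 ^ #rows (suc b) ≤? n
... | yes _ = suc b
... | no  _ = search n b

search-sound : ∀ n b → 1 ≤ n → 2 ^ #rows (search n b) ≤ n
search-sound n zero    1≤n = 1≤n
search-sound n (suc b) 1≤n with 2 ^ #rows (suc b) ≤? n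
... | yes le = le
... | no  _  = search-sound n b 1≤n

search-complete : ∀ n b {c} → c ≤ b → 2 ^ #rows c ≤ n → c ≤ search n b
search-complete n zero    z≤n le = z≤n
search-complete n (suc b) {c} c≤b le with 2 ^ #rows (suc b) ≤? n
... | yes _ = c≤b
... | no ¬p with m≤n⇒m<n∨m≡n c≤b
...   | inj₁ (s≤s c≤b′) = search-complete n b c≤b′ le
...   | inj₂ refl       = contradiction le ¬p

-- The greatest `c ≤ n` with `2 ^ #rows c ≤ n` (0 for `n = 0`), about the square root of `log n`.
-- Columns of at most `log n` bits fit into the input and keep CNFs over two of them polynomial,
-- while `c` still outgrows every constant.
groupSize : ℕ → ℕ
groupSize n = search n n

g : ∀ n → BoolFun ⌈ n log n ⌉
g n x = accept (groupSize n) (#rows (groupSize n)) n 1 (Vec.toList x)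

g-monotone : ∀ n → Monotone (g n)
g-monotone n x≼y = accept-mono (groupSize n) (#rows (groupSize n)) n ≤-refl (toList-≼ x≼y)
  where
  toList-≼ : ∀ {M} {x y : Vec Bool M} → VecPointwise.Pointwise _≤ᴮ_ x y → Vec.toList x ≼ Vec.toList y
  toList-≼ []       = []
  toList-≼ (b ∷ bs) = b ∷ toList-≼ bs

-- From `2 ^ k ≤ n` follows `2 ^ (k * n) ≤ n ^ n`; then logarithms are taken.
n*#rows≤nlogn : ∀ n → n * #rows (groupSize n) ≤ ⌈ n log n ⌉
n*#rows≤nlogn zero    = z≤n
n*#rows≤nlogn n@(suc _) = begin
  n * k                ≡⟨ *-comm n k ⟩
  k * n                ≡⟨ ⌈log₂2^n⌉≡n (k * n) ⟨
  ⌈log₂ 2 ^ (k * n) ⌉  ≡⟨ cong ⌈log₂_⌉ (^-*-assoc 2 k n) ⟨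
  ⌈log₂ (2 ^ k) ^ n ⌉  ≤⟨ ⌈log₂⌉-mono-≤ (^-monoˡ-≤ n (search-sound n n (s≤s z≤n))) ⟩
  ⌈log₂ n ^ n ⌉        ∎
  where
  open ≤-Reasoning
  k = #rows (groupSize n)

-- Samples against a small circuit

module _ (d n a : ℕ) where

  private
    X m c k M : ℕ
    -- The least `X` for which the rate `5 ^ d / X` after `d` levels is below 1; `m` is then the
    -- least number of positions that `half-confuses` admits.
    X = suc (5 ^ d)
    m = X * suc a
    c = groupSize n
    k = #rows c
    M = ⌈ n log n ⌉
  open Samples c m
  open Runs c

  cols≤ : ∀ t → cols t ≤ (3 * m) ^ t
  cols≤ t = proj₂ (go t)
    where
    open ≤-Reasoning
    lemma : ∀ m l → m * l + (m * l + m * l) ≡ 3 * m * l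
    lemma = solve-∀
    go : ∀ t → 1 ≤ cols t × cols t ≤ (3 * m) ^ t
    go zero    = ≤-refl , ≤-refl
    go (suc t) = ≤-trans (s≤s z≤n) (m≤n+m (suc (m * cols t)) (m * cols t)) , (begin
      m * cols t + (1 + m * cols t)          ≤⟨ +-monoʳ-≤ (m * cols t) (+-monoˡ-≤ (m * cols t) (*-mono-≤ {1} {m} {1} (s≤s z≤n) (proj₁ (go t)))) ⟩
      m * cols t + (m * cols t + m * cols t) ≡⟨ lemma m (cols t) ⟩
      3 * m * cols t                         ≤⟨ *-monoʳ-≤ (3 * m) (proj₂ (go t)) ⟩
      3 * m * (3 * m) ^ t                    ∎)

  -- Were `cols d ≤ n`, every sample would fit into the input, and the circuit would accept each `Y`
  -- and reject each `Z`: a rate of 1, against at most `5 ^ d / X`.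
  lower-bound : X ≤ c → d ≤ c → (C : Circuit Threshold M) → C Computes g n → depth C ≤ d → size C ≤ 2 ^ a → n < cols d
  lower-bound X≤c d≤c C C-g low small = ≰⇒> λ cols≤n → <⇒≱ ≤-refl (*-cancelʳ-≤ (suc (5 ^ d)) (5 ^ d) Q {{>-nonZero 1≤Q}} (begin
      X * Q                            ≡⟨ cong (X *_) (length≡∑1 (samples d)) ⟩
      X * ∑ (samples d) (λ _ → 1)      ≤⟨ *-monoʳ-≤ X (∑-All-mono (All.map (λ r → distinguishes cols≤n (r 0)) (samples-runs m d d≤c))) ⟩
      X * ∑ (samples d) (λ ω → beats (h (flat w (Y ω))) (h (flat w (Z ω)))) ≤⟨ Y-vs-Z (confused X≤c ≤-refl d (Class-circuit C small low)) (context [] w [] λ x → sym (++-identityʳ _)) ⟩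
      5 ^ d * Q                        ∎))
    where
    open ≤-Reasoning
    Q = length (samples d)
    1≤Q : 1 ≤ Q
    1≤Q = samples-nonempty (≤-trans (s≤s z≤n) X≤c) (s≤s z≤n) d
    w = List.replicate (k ∸ rows d) false
    h : List Bool → Bool
    h xs = eval C (encode M xs)
    k≡ : rows d + length w ≡ k
    k≡ = trans (cong (rows d +_) (length-replicate (k ∸ rows d))) (m+[n∸m]≡n (≤-trans (≤-reflexive (rows≡ m d)) (*-monoˡ-≤ c (+-monoʳ-≤ 2 d≤c))))
    ones-w : ones w ≡ 0
    ones-w = ones-zeros (k ∸ rows d)
    distinguishes : cols d ≤ n → ∀ {ω : Triple (rows d) (cols d)} →
      Run 0 1 (Y ω) 0 × Run 0 1 (Z ω) 1 × Run 0 1 (N ω) (2 + d + 0) →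
      1 ≤ beats (h (flat w (Y ω))) (h (flat w (Z ω)))
    distinguishes cols≤n {ω} (rY , rZ , _) = ≤-reflexive (sym (cong₂ beats
      (trans (C-g _) (subst (λ xs → accept c k n 1 xs ≡ true) (sym (proj₁ (proj₂ (padded (Y ω)))))
        (run-accept w k≡ (proj₂ (proj₂ (padded (Y ω)))) (subst (λ u → Run u 1 (Y ω) 0) (sym ones-w) rY) ≤-refl cols≤n)))
      (trans (C-g _) (subst (λ xs → accept c k n 1 xs ≡ false) (sym (proj₁ (proj₂ (padded (Z ω)))))
        (run-reject w k≡ (proj₂ (proj₂ (padded (Z ω)))) n (subst (λ u → Run u 1 (Z ω) 1) (sym ones-w) rZ) ≤-refl)))))
      where
      padded : (x : Block (rows d) (cols d)) → ∃[ zs ] Vec.toList (encode M (flat w x)) ≡ flat w x ++ zs × All (_≡ false) zs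
      padded x = toList-encode M (flat w x) (begin
        length (flat w x)                ≡⟨ length-flat w x ⟩
        cols d * (rows d + length w)     ≡⟨ cong (cols d *_) k≡ ⟩
        cols d * k                       ≤⟨ *-monoˡ-≤ k cols≤n ⟩
        n * k                            ≤⟨ n*#rows≤nlogn n ⟩
        M                                ∎)

-- Growth of the size

floor-log : ∀ s → 2 ≤ s → ∃[ a ] 1 ≤ a × 2 ^ a ≤ s × s < 2 ^ suc a
floor-log (suc zero) (s≤s ())
floor-log (suc (suc zero)) _ = 1 , ≤-refl , ≤-refl , s≤s (s≤s (s≤s z≤n))
floor-log (suc s@(suc (suc _))) _ with floor-log s (s≤s (s≤s z≤n))
... | a , 1≤a , lo , hi with m≤n⇒m<n∨m≡n hi
...   | inj₁ hi′ = a , 1≤a , m≤n⇒m≤1+n lo , hi′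
...   | inj₂ eq  = suc a , s≤s z≤n , ≤-reflexive (sym eq) , subst (_< 2 ^ suc (suc a)) (sym eq) (^-monoʳ-< 2 (s≤s (s≤s z≤n)) {suc a} ≤-refl)

n≤2^n : ∀ n → n ≤ 2 ^ n
n≤2^n zero    = z≤n
n≤2^n (suc n) = begin
  1 + n              ≤⟨ +-mono-≤ (m^n>0 2 n) (n≤2^n n) ⟩
  2 ^ n + 2 ^ n      ≡⟨ cong (2 ^ n +_) (+-identityʳ (2 ^ n)) ⟨
  2 * 2 ^ n          ∎
  where open ≤-Reasoning

*-^ : ∀ d m n → (m * n) ^ d ≡ m ^ d * n ^ d
*-^ zero    m n = refl
*-^ (suc d) m n rewrite *-^ d m n = lemma m n (m ^ d) (n ^ d)
  where
  lemma : ∀ m n x y → m * n * (x * y) ≡ m * x * (n * y)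
  lemma = solve-∀

-- For `2 ^ a ≤ s < 2 ^ suc a`, the bound on the columns gives `n < (3 * (X * (2 + a))) ^ d`, and
-- `2 + a ≤ 3 * a` turns this into `n < (9 * X * a) ^ d`; hence the constant `9 * X`.
majority-lower-bound : ∀ d → 2 ≤ d → MajorityLowerBound d g
majority-lower-bound d _ = 9 * X , _ , n₀ , conclusion
  where
  X n₀ : ℕ
  X = suc (5 ^ d)
  -- The first summand rules out `s ≤ 1`, by the bound at `a = 0`; the second makes `groupSize n` at
  -- least `X`.
  n₀ = (3 * (X * 1)) ^ d + 2 ^ #rows X
  d≤X : d ≤ X
  d≤X = ≤-trans (≤-trans (n≤2^n d) (^-monoˡ-≤ d (s≤s (s≤s z≤n)))) (n≤1+n _)

  conclusion : ∀ n → n₀ ≤ n → (C : MonotoneMajorityCircuit ⌈ n log n ⌉) → underlying C Computes g n →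
    depth (underlying C) ≤ d → AtLeast2^Root (9 * X) d n (size (underlying C))
  conclusion n n₀≤n C C-g low p q [9Xp]^d≤nq^d = begin
    2 ^ p            ≤⟨ ^-monoʳ-≤ 2 p≤aq ⟩
    2 ^ (a * q)      ≡⟨ ^-*-assoc 2 a q ⟨
    (2 ^ a) ^ q      ≤⟨ ^-monoˡ-≤ q 2^a≤s ⟩
    s ^ q            ∎
    where
    open ≤-Reasoning
    s : ℕ
    s = size (underlying C)
    X≤c : X ≤ groupSize n
    X≤c = search-complete n n (begin
        X             ≤⟨ m≤n*m X (2 + X) ⟩
        #rows X       ≤⟨ n≤2^n (#rows X) ⟩
        2 ^ #rows X   ≤⟨ m≤n+m _ ((3 * (X * 1)) ^ d) ⟩
        n₀            ≤⟨ n₀≤n ⟩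
        n             ∎)
      (≤-trans (m≤n+m _ ((3 * (X * 1)) ^ d)) n₀≤n)
    n<[3m]^d : ∀ a → s ≤ 2 ^ a → n < (3 * (X * suc a)) ^ d
    n<[3m]^d a small = ≤-trans (lower-bound d n a X≤c (≤-trans d≤X X≤c) (underlying C) C-g low small) (cols≤ d n a d)
    2≤s : 2 ≤ s
    2≤s = ≰⇒> λ s≤1 → <⇒≱ (n<[3m]^d 0 s≤1) (≤-trans (m≤m+n _ _) n₀≤n)
    a : ℕ
    a = proj₁ (floor-log s 2≤s)
    1≤a : 1 ≤ a
    1≤a = proj₁ (proj₂ (floor-log s 2≤s))
    2^a≤s : 2 ^ a ≤ s
    2^a≤s = proj₁ (proj₂ (proj₂ (floor-log s 2≤s)))
    s≤2^1+a : s ≤ 2 ^ suc a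
    s≤2^1+a = <⇒≤ (proj₂ (proj₂ (proj₂ (floor-log s 2≤s))))
    p≤aq : p ≤ a * q
    p≤aq = ≮⇒≥ λ aq<p → <-irrefl refl (begin-strict
      n * q ^ d                                 <⟨ *-monoˡ-< (q ^ d) {{m^n≢0 q d}} (n<[3m]^d (suc a) s≤2^1+a) ⟩
      (3 * (X * (2 + a))) ^ d * q ^ d           ≡⟨ *-^ d (3 * (X * (2 + a))) q ⟨
      (3 * (X * (2 + a)) * q) ^ d               ≤⟨ ^-monoˡ-≤ d (*-monoˡ-≤ q (*-monoʳ-≤ 3 (*-monoʳ-≤ X (+-monoˡ-≤ a (*-monoʳ-≤ 2 1≤a))))) ⟩
      (3 * (X * (2 * a + a)) * q) ^ d           ≡⟨ cong (_^ d) (lemma X a q) ⟩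
      (9 * X * (a * q)) ^ d                     ≤⟨ ^-monoˡ-≤ d (*-monoʳ-≤ (9 * X) (<⇒≤ aq<p)) ⟩
      (9 * X * p) ^ d                           ≤⟨ [9Xp]^d≤nq^d ⟩
      n * q ^ d                                 ∎)
      where
      lemma : ∀ X a q → 3 * (X * (2 * a + a)) * q ≡ 9 * X * (a * q)
      lemma = solve-∀

-- Circuits of depth 3

-- The state after reading a column with f ones, if it lies between 1 and c + 1.
next : ℕ → ℕ → ℕ
next c f = suc c ∸ f % suc c

-- `a′ + f % suc c` is a multiple of `suc c` strictly between 0 and `2 * suc c`, hence `suc c`
-- itself.
next-unique : ∀ c {a a′ f} → 1 ≤ a′ → a′ ≤ suc c → a * suc c ≡ f + a′ → a′ ≡ next c f
next-unique c {a} {a′} {f} 1≤a′ a′≤B e = begin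
  a′                 ≡⟨ m+n∸n≡m a′ r ⟨
  a′ + r ∸ r         ≡⟨ cong (_∸ r) (+-cancelʳ-≡ (q * suc c) (a′ + r) (suc c) (trans (sym sum) (cong (_* suc c) a≡1+q))) ⟩
  next c f           ∎
  where
  open ≡-Reasoning
  r = f % suc c
  q = f / suc c
  sum : a * suc c ≡ a′ + r + q * suc c
  sum = trans e (trans (cong (_+ a′) (m≡m%n+[m/n]*n f (suc c))) (lemma r (q * suc c) a′))
    where
    lemma : ∀ r s a → r + s + a ≡ a + r + s
    lemma = solve-∀
  q<a : q < a
  q<a = *-cancelʳ-< (suc c) q a (subst (q * suc c <_) (sym sum) (m<n+m (q * suc c) (≤-trans 1≤a′ (m≤m+n a′ r))))
  a<2+q : a < 2 + q
  a<2+q = *-cancelʳ-< (suc c) a (2 + q) (subst₂ _<_ (sym sum) (+-assoc (suc c) (suc c) (q * suc c))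
    (+-monoˡ-< (q * suc c) (+-mono-≤-< a′≤B (m%n<n f (suc c)))))
  a≡1+q : a ≡ suc q
  a≡1+q = ≤-antisym (s≤s⁻¹ a<2+q) q<a

-- Each step passes on the guess `next c f`, read off the latest column alone, and the equality test
-- confirms it. So every test involves two adjacent columns only.
locally-accept : (c k n a : ℕ) → List Bool → Bool
locally-accept c k zero    a xs = false
locally-accept c k (suc n) a xs = (a * suc c ≤ᵇ f) ∨ ((a * suc c ≡ᵇ f + next c f) ∧ locally-accept c k n (next c f) (drop k xs))
  where f = ones (take k xs)

ones-take : ∀ k xs → ones (take k xs) ≤ k
ones-take zero    xs       = z≤n
ones-take (suc k) []       = z≤n
ones-take (suc k) (b ∷ xs) = +-mono-≤ (⟦b⟧≤1 b) (ones-take k xs)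
  where
  ⟦b⟧≤1 : ∀ b → ⟦ b ⟧ ≤ 1
  ⟦b⟧≤1 true  = ≤-refl
  ⟦b⟧≤1 false = z≤n

large-state-grows : ∀ c {a f} → f ≤ #rows c → suc c < a → suc c + f < a * suc c
large-state-grows c {a} {f} f≤k B<a = begin
  suc (suc c + f)                   ≤⟨ s≤s (+-monoʳ-≤ (suc c) f≤k) ⟩
  suc (suc c + (2 + c) * c)         ≡⟨ lemma c ⟩
  (2 + c) * suc c                   ≤⟨ *-monoˡ-≤ (suc c) B<a ⟩
  a * suc c                         ∎
  where
  open ≤-Reasoning
  lemma : ∀ c → 1 + (1 + c + (2 + c) * c) ≡ (2 + c) * (1 + c)
  lemma = solve-∀

-- By `large-state-grows` a state above `suc c` stays there, and no column has enough ones to meet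
-- the deficit.
large-state-rejects : ∀ c n {a} xs → suc c < a → accept c (#rows c) n a xs ≡ false
large-state-rejects c zero    xs B<a = refl
large-state-rejects c (suc n) {a} xs B<a = cong₂ _∨_
  (≤ᵇ-false (≤-<-trans (m≤n+m f (suc c)) grows))
  (large-state-rejects c n (drop (#rows c) xs) (m+n<o⇒m<o∸n grows))
  where
  f = ones (take (#rows c) xs)
  grows = large-state-grows c {a} {f} (ones-take (#rows c) xs) B<a
  m+n<o⇒m<o∸n : ∀ {m n o} → m + n < o → m < o ∸ n
  m+n<o⇒m<o∸n {m} {n} {o} lt = subst (_< o ∸ n) (m+n∸n≡m m n) (∸-monoˡ-< lt (m≤n+m n m))

≡ᵇ-true : ∀ {m n} → m ≡ n → (m ≡ᵇ n) ≡ true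
≡ᵇ-true {m} refl with m ≡ᵇ m | ≡⇒≡ᵇ m m refl
... | true | _ = refl

≡ᵇ-false : ∀ {m n} → m ≢ n → (m ≡ᵇ n) ≡ false
≡ᵇ-false {m} {n} m≢n with m ≡ᵇ n in eq
... | false = refl
... | true  = contradiction (≡ᵇ⇒≡ m n (subst T (sym eq) _)) m≢n

accept≡locally-accept : ∀ c n a xs → accept c (#rows c) n a xs ≡ locally-accept c (#rows c) n a xs
accept≡locally-accept c zero    a xs = refl
accept≡locally-accept c (suc n) a xs with a * suc c ≤? f
  where f = ones (take (#rows c) xs)
... | yes aB≤f rewrite ≤ᵇ-true aB≤f = refl
... | no  aB≰f rewrite ≤ᵇ-false (≰⇒> aB≰f) with a * suc c ∸ f ≤? suc c
  where f = ones (take (#rows c) xs)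
...   | yes a′≤B = begin
  accept c k n (a * suc c ∸ f) xs′                                            ≡⟨ cong (λ b → accept c k n b xs′) a′≡next ⟩
  accept c k n (next c f) xs′                                                 ≡⟨ accept≡locally-accept c n (next c f) xs′ ⟩
  locally-accept c k n (next c f) xs′                                         ≡⟨ cong (_∧ locally-accept c k n (next c f) xs′) (≡ᵇ-true (trans (sym aB≡) (cong (f +_) a′≡next))) ⟨
  (a * suc c ≡ᵇ f + next c f) ∧ locally-accept c k n (next c f) xs′ ∎
  where
  open ≡-Reasoning
  k = #rows c
  f = ones (take k xs)
  xs′ = drop k xs
  aB≡ : f + (a * suc c ∸ f) ≡ a * suc c
  aB≡ = m+[n∸m]≡n (<⇒≤ (≰⇒> aB≰f))
  a′≡next : a * suc c ∸ f ≡ next c f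
  a′≡next = next-unique c {a} (m<n⇒0<n∸m (≰⇒> aB≰f)) a′≤B (sym aB≡)
-- `next` is at most `suc c`, so the equality test fails here, and `accept` rejects as well.
...   | no  a′≰B = trans (large-state-rejects c n xs′ (≰⇒> a′≰B))
    (cong (_∧ locally-accept c k n (next c f) xs′) (sym (≡ᵇ-false λ e →
      a′≰B (≤-trans (≤-reflexive (trans (cong (_∸ f) e) (m+n∸m≡n f (next c f)))) (m∸n≤m (suc c) (f % suc c))))))
  where
  k = #rows c
  f = ones (take k xs)
  xs′ = drop k xs

-- CNFs over two adjacent columns

windowCost : ℕ → ℕ
windowCost k = 2 ^ (k + k) * (2 + (k + k))

-- A `Term` is a CNF rather than a conjunction of literals: an OR of terms has depth 3, and the
-- conjunction of two terms is their concatenation.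
Clause Term : ℕ → Set
Clause M = List (Literal M)
Term   M = List (Clause M)

module _ {M : ℕ} where

  evalClause : Vec Bool M → Clause M → Bool
  evalClause x ls = or (List.map (readLiteral x) ls)

  evalTerm : Vec Bool M → Term M → Bool
  evalTerm x cs = and (List.map (evalClause x) cs)

  evalDNF : Vec Bool M → List (Term M) → Bool
  evalDNF x ts = or (List.map (evalTerm x) ts)

  bits : Vec Bool M → List (Fin M) → List Bool
  bits x = List.map (Vec.lookup x)

  -- One clause for each falsifying assignment. A clause from the branch where `v` is `false`
  -- contains `pos v`, hence holds as soon as `v` is `true`.
  cnf : List (Fin M) → (List Bool → Bool) → Term M
  cnf []       p = if p [] then [] else [] ∷ []
  cnf (v ∷ vs) p = List.map (pos v ∷_) (cnf vs (p ∘ (false ∷_))) ++ List.map (neg v ∷_) (cnf vs (p ∘ (true ∷_)))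

  evalTerm-++ : ∀ x cs ds → evalTerm x (cs ++ ds) ≡ evalTerm x cs ∧ evalTerm x ds
  evalTerm-++ x []       ds = refl
  evalTerm-++ x (c ∷ cs) ds rewrite evalTerm-++ x cs ds = sym (Bool.∧-assoc (evalClause x c) _ _)

  evalTerm-∷ : ∀ x ℓ cs → evalTerm x (List.map (ℓ ∷_) cs) ≡ readLiteral x ℓ ∨ evalTerm x cs
  evalTerm-∷ x ℓ []       = sym (Bool.∨-zeroʳ (readLiteral x ℓ))
  evalTerm-∷ x ℓ (c ∷ cs) rewrite evalTerm-∷ x ℓ cs = sym (Bool.∨-distribˡ-∧ (readLiteral x ℓ) _ _)

  cnf-correct : ∀ x vs p → evalTerm x (cnf vs p) ≡ p (bits x vs)
  cnf-correct x [] p with p []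
  ... | true  = refl
  ... | false = refl
  cnf-correct x (v ∷ vs) p
    rewrite evalTerm-++ x (List.map (pos v ∷_) (cnf vs (p ∘ (false ∷_)))) (List.map (neg v ∷_) (cnf vs (p ∘ (true ∷_))))
          | evalTerm-∷ x (pos v) (cnf vs (p ∘ (false ∷_))) | evalTerm-∷ x (neg v) (cnf vs (p ∘ (true ∷_)))
          | cnf-correct x vs (p ∘ (false ∷_)) | cnf-correct x vs (p ∘ (true ∷_)) with Vec.lookup x v
  ... | true  = refl
  ... | false = Bool.∧-identityʳ _

  window : List (Fin M) → List (Fin M) → (List Bool → List Bool → Bool) → Term M
  window us vs p = cnf (us ++ vs) (λ bs → p (take (length us) bs) (drop (length us) bs))

  window-correct : ∀ x us vs p → evalTerm x (window us vs p) ≡ p (bits x us) (bits x vs)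
  window-correct x us vs p = trans (cnf-correct x (us ++ vs) _) (cong₂ p
    (trans (cong (take (length us)) (map-++ (Vec.lookup x) us vs)) (take-length-++ (bits x us) (sym (length-map _ us))))
    (trans (cong (drop (length us)) (map-++ (Vec.lookup x) us vs)) (drop-length-++ (bits x us) (sym (length-map _ us)))))

  accepts-now continues : ℕ → (List Bool → ℕ) → List Bool → List Bool → Bool
  accepts-now c st us vs = st us * suc c ≤ᵇ ones vs
  continues   c st us vs = st us * suc c ≡ᵇ ones vs + next c (ones vs)

  -- us are the variables of the previous column, which determine the state st us.
  dnf : (c k n : ℕ) → (List Bool → ℕ) → List (Fin M) → List (Fin M) → List (Term M)
  dnf c k zero    st us vs = []
  dnf c k (suc n) st us vs =
    window us (take k vs) (accepts-now c st)
    ∷ List.map (window us (take k vs) (continues c st) ++_) (dnf c k n (next c ∘ ones) (take k vs) (drop k vs))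

  evalDNF-++ : ∀ x cs ts → evalDNF x (List.map (cs ++_) ts) ≡ evalTerm x cs ∧ evalDNF x ts
  evalDNF-++ x cs []       = sym (Bool.∧-zeroʳ _)
  evalDNF-++ x cs (t ∷ ts) rewrite evalDNF-++ x cs ts | evalTerm-++ x cs t = sym (Bool.∧-distribˡ-∨ (evalTerm x cs) _ _)

  dnf-correct : ∀ x c k n st us vs → evalDNF x (dnf c k n st us vs) ≡ locally-accept c k n (st (bits x us)) (bits x vs)
  dnf-correct x c k zero    st us vs = refl
  dnf-correct x c k (suc n) st us vs
    rewrite evalDNF-++ x (window us (take k vs) (continues c st)) (dnf c k n (next c ∘ ones) (take k vs) (drop k vs))
          | window-correct x us (take k vs) (accepts-now c st) | window-correct x us (take k vs) (continues c st)
          | dnf-correct x c k n (next c ∘ ones) (take k vs) (drop k vs)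
          | take-map {f = Vec.lookup x} k vs | drop-map {f = Vec.lookup x} k vs = refl

  -- Besides the literals, one wire for the constant input of the gate and one for the wire leaving
  -- it; likewise for terms. No wire leaves the output gate, so `dnfCost` adds only 1.
  clauseCost : Clause M → ℕ
  clauseCost ls = 2 + length ls

  termCost : Term M → ℕ
  termCost cs = 2 + ∑ cs clauseCost

  -- The offset `e` generalises the induction: each variable adds one literal to every clause.
  ∑-cnf : ∀ e vs p → ∑ (cnf vs p) (λ c → e + length c) ≤ 2 ^ length vs * (e + length vs)
  ∑-cnf e [] p with p []
  ... | true  = z≤n
  ... | false = ≤-refl
  ∑-cnf e (v ∷ vs) p = begin
    ∑ (List.map (pos v ∷_) c₀ ++ List.map (neg v ∷_) c₁) cost  ≡⟨ ∑-++ (List.map (pos v ∷_) c₀) _ cost ⟩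
    ∑ (List.map (pos v ∷_) c₀) cost + ∑ (List.map (neg v ∷_) c₁) cost
      ≡⟨ cong₂ _+_ (trans (∑-map (pos v ∷_) c₀ cost) (∑-cong c₀ (λ c → +-suc e (length c))))
                   (trans (∑-map (neg v ∷_) c₁ cost) (∑-cong c₁ (λ c → +-suc e (length c)))) ⟩
    ∑ c₀ (λ c → suc e + length c) + ∑ c₁ (λ c → suc e + length c)
      ≤⟨ +-mono-≤ (∑-cnf (suc e) vs _) (∑-cnf (suc e) vs _) ⟩
    2 ^ length vs * (suc e + length vs) + 2 ^ length vs * (suc e + length vs) ≡⟨ lemma (2 ^ length vs) e (length vs) ⟩
    2 ^ suc (length vs) * (e + suc (length vs)) ∎
    where
    open ≤-Reasoning
    c₀ = cnf vs (p ∘ (false ∷_))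
    c₁ = cnf vs (p ∘ (true ∷_))
    cost : Clause M → ℕ
    cost c = e + length c
    lemma : ∀ w e l → w * (1 + e + l) + w * (1 + e + l) ≡ 2 * w * (e + (1 + l))
    lemma = solve-∀

  length-take≤ : ∀ k (vs : List (Fin M)) → length (take k vs) ≤ k
  length-take≤ k vs = ≤-trans (≤-reflexive (length-take k vs)) (m⊓n≤m k _)

  ∑-window : ∀ k us vs p → length us ≤ k → length vs ≤ k → ∑ (window us vs p) clauseCost ≤ windowCost k
  ∑-window k us vs p us≤k vs≤k = ≤-trans (∑-cnf 2 (us ++ vs) _) (*-mono-≤ (^-monoʳ-≤ 2 l≤) (+-monoʳ-≤ 2 l≤))
    where
    l≤ : length (us ++ vs) ≤ k + k
    l≤ = ≤-trans (≤-reflexive (length-++ us)) (+-mono-≤ us≤k vs≤k)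

  length-dnf : ∀ c k n st us vs → length (dnf c k n st us vs) ≡ n
  length-dnf c k zero    st us vs = refl
  length-dnf c k (suc n) st us vs = cong suc (trans (length-map _ (dnf c k n _ _ _)) (length-dnf c k n _ _ _))

  dnfCost : List (Term M) → ℕ
  dnfCost ts = 1 + ∑ ts termCost

  -- There are `n` terms, each composed of at most `n` windows.
  ∑-dnf : ∀ c k n st us vs → length us ≤ k → ∑ (dnf c k n st us vs) termCost ≤ n * (2 + n * windowCost k)
  ∑-dnf c k zero    st us vs us≤k = z≤n
  ∑-dnf c k (suc n) st us vs us≤k = begin
    termCost w₀ + ∑ (List.map (w₁ ++_) ts) termCost
      ≡⟨ cong (termCost w₀ +_) (trans (∑-map (w₁ ++_) ts termCost) (∑-cong ts λ t → trans (cong (2 +_) (∑-++ w₁ t clauseCost)) (lemma₁ (∑ w₁ clauseCost) _))) ⟩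
    termCost w₀ + ∑ ts (λ t → ∑ w₁ clauseCost + termCost t)
      ≡⟨ cong (termCost w₀ +_) (∑-+ ts _ termCost) ⟩
    termCost w₀ + (∑ ts (λ _ → ∑ w₁ clauseCost) + ∑ ts termCost)
      ≡⟨ cong (λ s → termCost w₀ + (s + ∑ ts termCost)) (trans (∑-const ts _) (cong (_* ∑ w₁ clauseCost) (length-dnf c k n _ _ _))) ⟩
    termCost w₀ + (n * ∑ w₁ clauseCost + ∑ ts termCost)
      ≤⟨ +-mono-≤ (+-monoʳ-≤ 2 (∑-window k us (take k vs) (accepts-now c st) us≤k (length-take≤ k vs)))
          (+-mono-≤ (*-monoʳ-≤ n (∑-window k us (take k vs) (continues c st) us≤k (length-take≤ k vs)))
                    (∑-dnf c k n (next c ∘ ones) (take k vs) (drop k vs) (length-take≤ k vs))) ⟩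
    2 + windowCost k + (n * windowCost k + n * (2 + n * windowCost k))
      ≤⟨ m≤m+n _ (n * windowCost k) ⟩
    2 + windowCost k + (n * windowCost k + n * (2 + n * windowCost k)) + n * windowCost k
      ≡⟨ lemma₂ n (windowCost k) ⟩
    suc n * (2 + suc n * windowCost k) ∎
    where
    open ≤-Reasoning
    w₀ = window us (take k vs) (accepts-now c st)
    w₁ = window us (take k vs) (continues c st)
    ts = dnf c k n (next c ∘ ones) (take k vs) (drop k vs)
    lemma₁ : ∀ a b → 2 + (a + b) ≡ a + (2 + b)
    lemma₁ = solve-∀
    lemma₂ : ∀ n W → 2 + W + (n * W + n * (2 + n * W)) + n * W ≡ (1 + n) * (2 + (1 + n) * W)
    lemma₂ = solve-∀

-- Compilation into circuits

module _ {M : ℕ} where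

  private
    G : ℕ → Set
    G = Gates AndOrNot M
    variable
      k k′ k″ : ℕ

  infix 4 _⊑_
  -- Since gates are only added on top, a node of `gs` keeps its value and height once its index is
  -- shifted.
  data _⊑_ (gs : G k) : G k′ → Set where
    done : gs ⊑ gs
    step : ∀ {gs′ : G k′} {op ws} → gs ⊑ gs′ → gs ⊑ (gs′ ▷ op ∙ ws)

  ⊑-trans : {gs : G k} {gs′ : G k′} {gs″ : G k″} → gs ⊑ gs′ → gs′ ⊑ gs″ → gs ⊑ gs″
  ⊑-trans e done      = e
  ⊑-trans e (step e′) = step (⊑-trans e e′)

  shift : {gs : G k} {gs′ : G k′} → gs ⊑ gs′ → Node AndOrNot M k → Node AndOrNot M k′
  shift e        (input ℓ) = input ℓ
  shift done     (gate i)  = gate i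
  shift (step e) (gate i) with shift e (gate i)
  ... | input ℓ = input ℓ
  ... | gate j  = gate (suc j)

  module _ {A : Set} (onInput : Literal M → A) (onGate : AndOr → List⁺ A → A) where

    fold : G k → Node AndOrNot M k → A
    fold gs = atNode {AndOrNot} onInput onGate (atGates onInput onGate gs)

    fold-shift : {gs : G k} {gs′ : G k′} (e : gs ⊑ gs′) (v : Node AndOrNot M k) → fold gs′ (shift e v) ≡ fold gs v
    fold-shift e        (input ℓ) = refl
    fold-shift done     (gate i)  = refl
    fold-shift (step e) (gate i) with shift e (gate i) | fold-shift e (gate i)
    ... | input ℓ | eq = eq
    ... | gate j  | eq = eq

  value : Vec Bool M → G k → Node AndOrNot M k → Bool
  value x = fold (readLiteral x) applyAndOr

  height : G k → Node AndOrNot M k → ℕ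
  height = fold (λ _ → 0) (λ _ ds → suc (foldr₁ _⊔_ ds))

  record Extends (gs : G k) (cost : ℕ) : Set where
    constructor extends
    field
      {#gates}  : ℕ
      {result}  : G #gates
      extension : gs ⊑ result
      wires     : #wires result ≡ cost + #wires gs
  open Extends

  record Realised (gs : G k) (f : Vec Bool M → Bool) (D cost : ℕ) : Set where
    constructor realised
    field
      extended : Extends gs cost
      node     : Node AndOrNot M (#gates extended)
      computes : ∀ x → value x (result extended) node ≡ f x
      shallow  : height (result extended) node ≤ D

  record AllRealised (gs : G k) (fs : A → Vec Bool M → Bool) (as : List A) (D cost : ℕ) : Set where
    constructor allRealised
    field
      extended : Extends gs cost
      nodes    : List (Node AndOrNot M (#gates extended))
      #nodes   : length nodes ≡ length as
      computes : ∀ x → List.map (value x (result extended)) nodes ≡ List.map (λ a → fs a x) as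
      shallow  : All (λ v → height (result extended) v ≤ D) nodes

  module _ {D : ℕ} (fs : A → Vec Bool M → Bool) (cost : A → ℕ)
    (realise : ∀ {k} (gs : G k) a → Realised gs (fs a) D (cost a)) where

    realise-all : (gs : G k) (as : List A) → AllRealised gs fs as D (∑ as cost)
    realise-all gs []       = allRealised (extends done refl) [] refl (λ _ → refl) []
    realise-all gs (a ∷ as)
      with realised (extends {result = gs₁} e₁ w₁) v c₁ s₁ ← realise gs a
      with allRealised (extends {result = gs₂} e₂ w₂) vs # c₂ s₂ ← realise-all gs₁ as =
      allRealised
        (extends (⊑-trans e₁ e₂) (trans w₂ (trans (cong (∑ as cost +_) w₁) (lemma (∑ as cost) (cost a) (#wires gs)))))
        (shift e₂ v ∷ vs)
        (cong suc #)
        (λ x → cong₂ _∷_ (trans (fold-shift (readLiteral x) applyAndOr e₂ v) (c₁ x)) (c₂ x))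
        (≤-trans (≤-reflexive (fold-shift _ _ e₂ v)) s₁ ∷ s₂)
      where
      lemma : ∀ s c w → s + (c + w) ≡ c + s + w
      lemma = solve-∀

    -- The extra constant wire carries the unit of the operation: it makes the
    -- list of wires nonempty.
    realise-gate : (op : AndOr) (unit : Bool) (combine : List Bool → Bool) → (∀ bs → applyAndOr op (unit ∷ bs) ≡ combine bs) →
      (gs : G k) (as : List A) →
      Realised gs (λ x → combine (List.map (λ a → fs a x) as)) (suc D) (1 + length as + ∑ as cost)
    realise-gate op unit combine unital gs as
      with allRealised (extends {result = gs′} e w) vs # c s ← realise-all gs as =
      realised
        (extends {result = gs′ ▷ op ∙ (input (const unit) ∷ vs)} (step e)
          (trans (cong₂ (λ l w → suc l + w) # w) (sym (+-assoc (suc (length as)) (∑ as cost) (#wires gs)))))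
        (gate zero)
        (λ x → trans (cong (λ bs → applyAndOr op (unit ∷ bs)) (c x)) (unital _))
        (s≤s (foldr₁-⊔-≤⁻ (height gs′) (input (const unit)) vs z≤n s))
      where
      foldr₁-⊔-≤⁻ : ∀ {B : Set} {t} (f : B → ℕ) x xs → f x ≤ t → All (λ x → f x ≤ t) xs → foldr₁ _⊔_ (List⁺.map f (x ∷ xs)) ≤ t
      foldr₁-⊔-≤⁻ f x []       x≤ []          = x≤
      foldr₁-⊔-≤⁻ f x (y ∷ ys) x≤ (y≤ ∷ ys≤) = ⊔-lub x≤ (foldr₁-⊔-≤⁻ f y ys y≤ ys≤)

  realise-literal : (gs : G k) (ℓ : Literal M) → Realised gs (λ x → readLiteral x ℓ) 0 0
  realise-literal gs ℓ = realised (extends done refl) (input ℓ) (λ _ → refl) z≤n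

  clauseWires : Clause M → ℕ
  clauseWires ls = 1 + length ls + ∑ ls (λ _ → 0)

  termWires : Term M → ℕ
  termWires cs = 1 + length cs + ∑ cs clauseWires

  realise-clause : (gs : G k) (ls : Clause M) → Realised gs (λ x → evalClause x ls) 1 (clauseWires ls)
  realise-clause = realise-gate (λ ℓ x → readLiteral x ℓ) (λ _ → 0) realise-literal OR false or (λ _ → refl)

  realise-term : (gs : G k) (cs : Term M) → Realised gs (λ x → evalTerm x cs) 2 (termWires cs)
  realise-term = realise-gate (λ c x → evalClause x c) clauseWires realise-clause AND true and (λ _ → refl)

  realise-dnf : (gs : G k) (ts : List (Term M)) → Realised gs (λ x → evalDNF x ts) 3 (1 + length ts + ∑ ts termWires)
  realise-dnf = realise-gate (λ t x → evalTerm x t) termWires realise-term OR false or (λ _ → refl)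

  dnfCost≡ : ∀ ts → 1 + length ts + ∑ ts termWires ≡ dnfCost ts
  dnfCost≡ ts = trans (cong (λ l → suc (l + ∑ ts termWires)) (length≡∑1 ts))
    (cong suc (trans (sym (∑-+ ts (λ _ → 1) termWires)) (∑-cong ts term≡)))
    where
    clause≡ : ∀ ls → 1 + clauseWires ls ≡ clauseCost ls
    clause≡ ls = cong (2 +_) (trans (cong (length ls +_) (trans (∑-const ls 0) (*-zeroʳ (length ls)))) (+-identityʳ (length ls)))
    term≡ : ∀ cs → 1 + termWires cs ≡ termCost cs
    term≡ cs = cong (2 +_) (trans (cong (_+ ∑ cs clauseWires) (length≡∑1 cs))
      (trans (sym (∑-+ cs (λ _ → 1) clauseWires)) (∑-cong cs clause≡)))

  realised-circuit : ∀ {f D cost} → Realised [] f D cost →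
    Σ[ C ∈ Circuit AndOrNot M ] C Computes f × depth C ≤ D × size C ≡ cost
  realised-circuit (realised (extends {result = gs} _ wires) v computes shallow) =
    circuit gs v , computes , shallow , trans wires (+-identityʳ _)

  dnf-circuit : (ts : List (Term M)) → Σ[ C ∈ Circuit AndOrNot M ] C Computes (λ x → evalDNF x ts) × depth C ≤ 3 × size C ≡ dnfCost ts
  dnf-circuit ts =
    let C , computes , shallow , size≡ = realised-circuit (realise-dnf [] ts)
    in C , computes , shallow , trans size≡ (dnfCost≡ ts)

-- Polynomial size

2+n^e≤n^1+e : ∀ {n} e → 2 ≤ n → 1 ≤ e → 2 + n ^ e ≤ n ^ suc e
2+n^e≤n^1+e {n@(suc _)} e 2≤n 1≤e = begin
  2 + n ^ e        ≤⟨ +-monoˡ-≤ (n ^ e) (≤-trans 2≤n (≤-trans (≤-reflexive (sym (^-identityʳ n))) (^-monoʳ-≤ n 1≤e))) ⟩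
  n ^ e + n ^ e    ≡⟨ cong (n ^ e +_) (+-identityʳ (n ^ e)) ⟨
  2 * n ^ e        ≤⟨ *-monoˡ-≤ (n ^ e) 2≤n ⟩
  n ^ suc e        ∎
  where open ≤-Reasoning

cost-bound : ∀ n {s w} → 1 ≤ n → s ≤ n * (2 + n * w) → w ≤ n ^ 2 * (2 + n ^ 2) → 1 + s ≤ n ^ 9 + 9
-- At `n = 1` higher powers absorb no constants; `s ≤ 5` is computed directly.
cost-bound 1 {s} {w} _ s≤ w≤ = s≤s (≤-trans s≤ (≤-trans (+-monoˡ-≤ 0 (+-monoʳ-≤ 2 (+-monoˡ-≤ 0 w≤))) (m≤m+n 5 4)))
cost-bound n@(suc (suc _)) {s} {w} _ s≤ w≤ = begin
  1 + s                            ≤⟨ s≤s s≤ ⟩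
  1 + n * (2 + n * w)              ≤⟨ s≤s (*-monoʳ-≤ n (+-monoʳ-≤ 2 (*-monoʳ-≤ n (≤-trans w≤ (*-monoʳ-≤ (n ^ 2) (2+n^e≤n^1+e 2 2≤n (s≤s z≤n))))))) ⟩
  1 + n * (2 + n * (n ^ 2 * n ^ 3)) ≡⟨ cong (λ p → 1 + n * (2 + n * p)) (^-distribˡ-+-* n 2 3) ⟨
  1 + n * (2 + n ^ 6)              ≤⟨ s≤s (*-monoʳ-≤ n (2+n^e≤n^1+e 6 2≤n (s≤s z≤n))) ⟩
  1 + n ^ 8                        ≤⟨ n≤1+n _ ⟩
  2 + n ^ 8                        ≤⟨ 2+n^e≤n^1+e 8 2≤n (s≤s z≤n) ⟩
  n ^ 9                            ≤⟨ m≤m+n _ 9 ⟩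
  n ^ 9 + 9                        ∎
  where
  open ≤-Reasoning
  2≤n : 2 ≤ n
  2≤n = s≤s (s≤s z≤n)

-- Both factors are controlled by `2 ^ k ≤ n`: the number of clauses directly, their length through
-- `k + k ≤ 2 ^ (k + k)`.
windowCost-bound : ∀ n → 1 ≤ n → windowCost (#rows (groupSize n)) ≤ n ^ 2 * (2 + n ^ 2)
windowCost-bound n 1≤n = *-mono-≤ 2^2k≤ (+-monoʳ-≤ 2 (≤-trans (n≤2^n (k + k)) 2^2k≤))
  where
  k : ℕ
  k = #rows (groupSize n)
  2^2k≤ : 2 ^ (k + k) ≤ n ^ 2
  2^2k≤ = begin
    2 ^ (k + k)    ≡⟨ ^-distribˡ-+-* 2 k k ⟩
    2 ^ k * 2 ^ k  ≤⟨ *-mono-≤ (search-sound n n 1≤n) (search-sound n n 1≤n) ⟩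
    n * n          ≡⟨ cong (n *_) (*-identityʳ n) ⟨
    n ^ 2          ∎
    where open ≤-Reasoning

-- Before the first column there are no variables to look at, and the state is the constant 1.
g-dnf : ∀ n → List (Term ⌈ n log n ⌉)
g-dnf n = dnf (groupSize n) (#rows (groupSize n)) n (λ _ → 1) [] (Vec.toList (Vec.allFin ⌈ n log n ⌉))

g-dnf-correct : ∀ n x → evalDNF x (g-dnf n) ≡ g n x
g-dnf-correct n x = begin
  evalDNF x (g-dnf n)                                 ≡⟨ dnf-correct x c k n (λ _ → 1) [] variables ⟩
  locally-accept c k n 1 (bits x variables)           ≡⟨ accept≡locally-accept c n 1 (bits x variables) ⟨
  accept c k n 1 (bits x variables)                   ≡⟨ cong (accept c k n 1) (toList-map (Vec.lookup x) (Vec.allFin _)) ⟨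
  accept c k n 1 (Vec.toList (Vec.map (Vec.lookup x) (Vec.allFin _))) ≡⟨ cong (accept c k n 1 ∘ Vec.toList) (map-lookup-allFin x) ⟩
  g n x                                               ∎
  where
  open ≡-Reasoning
  c k : ℕ
  c = groupSize n
  k = #rows c
  variables : List (Fin ⌈ n log n ⌉)
  variables = Vec.toList (Vec.allFin _)

g-dnf-cost : ∀ n → dnfCost (g-dnf n) ≤ n ^ 9 + 9
g-dnf-cost zero      = s≤s z≤n
g-dnf-cost n@(suc _) = cost-bound n (s≤s z≤n)
  (∑-dnf (groupSize n) (#rows (groupSize n)) n (λ _ → 1) [] (Vec.toList (Vec.allFin ⌈ n log n ⌉)) z≤n)
  (windowCost-bound n (s≤s z≤n))

g-circuit : ∀ n → Σ[ C ∈ Circuit AndOrNot ⌈ n log n ⌉ ] C Computes g n × depth C ≤ 3 × size C ≤ n ^ 9 + 9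
g-circuit n =
  let C , computes , shallow , size≡ = dnf-circuit (g-dnf n)
  in C , (λ x → trans (computes x) (g-dnf-correct n x)) , shallow , ≤-trans (≤-reflexive size≡) (g-dnf-cost n)

n≤nlogn : ∀ n → 2 ≤ n → n ≤ ⌈ n log n ⌉
n≤nlogn n 2≤n = ≤-trans (≤-reflexive (sym (⌈log₂2^n⌉≡n n))) (⌈log₂⌉-mono-≤ (^-monoˡ-≤ n 2≤n))

poly-in-nlogn : ∀ n → n ^ 9 + 9 ≤ ⌈ n log n ⌉ ^ 10 + 10
poly-in-nlogn zero       = m≤m+n 9 1
-- Here `⌈ 1 log 1 ⌉ = 0` and both sides are 10, which is why the additive constant is 10.
poly-in-nlogn (suc zero) = ≤-refl
poly-in-nlogn n@(suc (suc _)) = +-mono-≤ (≤-trans (^-monoˡ-≤ 9 n≤N) (^-monoʳ-≤ ⌈ n log n ⌉ {{>-nonZero (≤-trans (s≤s z≤n) n≤N)}} (m≤m+n 9 1))) (m≤m+n 9 1)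
  where n≤N = n≤nlogn n (s≤s (s≤s z≤n))

theorem3 : Σ[ g ∈ ((n : ℕ) → BoolFun ⌈ n log n ⌉) ]
    (∀ n → Monotone (g n))
    × (AC⁰ g × HasPolySizeDepth 3 id g)
    × (∀ d → 2 ≤ d → MajorityLowerBound d g)
theorem3 =
  g , g-monotone ,
  ((3 , 10 , λ n → let C , C-g , low , small = g-circuit n in C , C-g , low , ≤-trans small (poly-in-nlogn n)) , (9 , g-circuit)) ,
  majority-lower-bound
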